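{- Let $m,n$ be natural numbers (positive integers) with $m\ne 1$ and $n\neq 1$, and let $K_{m,n}$ be the complete bipartite graph with parts of sizes $m$ and $n$. Then: (i) the Randić characteristic polynomial of $K_{m,n}$ is $RP(K_{m,n},\lambda)=\lambda^{m+n-2}(\lambda^2-1)$; (ii) the Randić energy of $K_{m,n}$ is $RE(K_{m,n})=2$.
   Context: All graphs are finite and simple. For a graph $G$ with vertices $v_1,\dots,v_N$ of degrees $d_1,\dots,d_N$, the Randić matrix $R(G)$ is the $N\times N$ real symmetric matrix with $(i,j)$-entry $\frac{1}{\sqrt{d_id_j}}$ if $v_i$ and $v_j$ are adjacent, and $0$ otherwise. The Randić characteristic polynomial of $G$ is $RP(G,\lambda)=\det(\lambda I-R(G))$. The Randić energy of $G$ is $RE(G)=\sum_{i=1}^N|\rho_i|$, where $\rho_1,\dots,\rho_N$ are the eigenvalues of $R(G)$ counted with multiplicity. -}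

module Defs where

open import Algebra.Bundles.Raw using (RawRing)
open import Data.Empty using (⊥)
open import Data.Fin.Base using (Fin; zero; suc; toℕ; splitAt; punchIn)
open import Data.Fin.Properties using (_≟_)
open import Data.Integer.Base as ℤ using (+_; +[1+_])
import Data.Integer.Properties as ℤ
open import Data.List.Base using (List; []; _∷_; length; filter; allFin)
open import Data.List.Membership.Propositional using (_∈_)
open import Data.List.Membership.Propositional.Properties using (∈-filter⁺; ∈-allFin)
open import Data.List.Relation.Unary.Any using (here; there)
open import Data.Nat.Base as ℕ using (ℕ; zero; suc; NonZero; _⊔_; s≤s; z≤n)
import Data.Nat.Properties as ℕ
import Data.Nat.Tactic.RingSolver as ℕ
open import Data.Product using (Σ; Σ-syntax; ∃-syntax; _×_; _,_; proj₁; proj₂)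
open import Data.Rational.Base as ℚ using (ℚ; mkℚ; 0ℚ; 1ℚ; ½; toℚᵘ)
import Data.Rational.Properties as ℚ
import Data.Rational.Unnormalised.Base as ℚᵘ
import Data.Rational.Unnormalised.Properties as ℚᵘ
open import Data.Sum.Base using (_⊎_; inj₁; inj₂)
open import Data.Unit.Base using (⊤; tt)
open import Data.Vec.Functional using (Vector)
open import Level using (0ℓ)
open import Relation.Binary.Core using (Rel)
open import Relation.Binary.Definitions using (Decidable; Symmetric; Irreflexive)
open import Relation.Binary.PropositionalEquality using (_≡_; _≢_; refl; sym; trans; cong; cong₂; subst; subst₂)
open import Relation.Nullary using (¬_; yes; no; contradiction)
open import Relation.Nullary.Decidable using (dec⇒maybe)
open import Tactic.RingSolver using (solve-∀)
open import Tactic.RingSolver.Core.AlmostCommutativeRing using (AlmostCommutativeRing; fromCommutativeRing)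

ℚ-ring : AlmostCommutativeRing 0ℓ 0ℓ
ℚ-ring = fromCommutativeRing ℚ.+-*-commutativeRing (λ p → dec⇒maybe (0ℚ ℚ.≟ p))

private
  telescope : ∀ a b → (a ℚ.- b) ℚ.+ b ≡ a
  telescope = solve-∀ ℚ-ring

  +-cancel : ∀ a b → (a ℚ.+ b) ℚ.- b ≡ a
  +-cancel = solve-∀ ℚ-ring

  neg-flip : ∀ a b → b ℚ.- a ≡ ℚ.- (a ℚ.- b)
  neg-flip = solve-∀ ℚ-ring

  neg-flip′ : ∀ a b → b ℚ.- a ≡ (ℚ.- a) ℚ.- (ℚ.- b)
  neg-flip′ = solve-∀ ℚ-ring

  regroup : ∀ a a′ b b′ → (a ℚ.- a′) ℚ.+ (b ℚ.- b′) ≡ (a ℚ.+ b) ℚ.- (a′ ℚ.+ b′)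
  regroup = solve-∀ ℚ-ring

  split : ∀ a a′ b b′ → a ℚ.* (b ℚ.- b′) ℚ.+ b′ ℚ.* (a ℚ.- a′) ≡ a ℚ.* b ℚ.- a′ ℚ.* b′
  split = solve-∀ ℚ-ring

  expand : ∀ a b u v → u ℚ.* (b ℚ.* v) ℚ.- v ℚ.* (a ℚ.* u) ≡ (b ℚ.- a) ℚ.* (u ℚ.* v)
  expand = solve-∀ ℚ-ring

  rearrange : ∀ c d u v → (c ℚ.* c) ℚ.* (d ℚ.* (u ℚ.* v)) ≡ d ℚ.* ((c ℚ.* u) ℚ.* (c ℚ.* v))
  rearrange = solve-∀ ℚ-ring

  suc-arith : ∀ a D → suc a ℕ.* (D ℕ.* D) ≡ (a ℕ.* D ℕ.+ 1 ℕ.* D) ℕ.* D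
  suc-arith = ℕ.solve-∀

  *-swap : ∀ a b → (a ℕ.* b) ℕ.* (a ℕ.* b) ≡ (a ℕ.* a) ℕ.* (b ℕ.* b)
  *-swap = ℕ.solve-∀

  *-swap′ : ∀ a b c → (a ℕ.* b) ℕ.* c ≡ (a ℕ.* c) ℕ.* b
  *-swap′ = ℕ.solve-∀

abstract
  triangle : ∀ {p q δ ε} → ℚ.∣ p ∣ ℚ.< δ → ℚ.∣ q ∣ ℚ.< ε → ℚ.∣ p ℚ.+ q ∣ ℚ.< δ ℚ.+ ε
  triangle {p} {q} p<δ q<ε = ℚ.≤-<-trans (ℚ.∣p+q∣≤∣p∣+∣q∣ p q) (ℚ.+-mono-< p<δ q<ε)

  half+half : ∀ ε → ½ ℚ.* ε ℚ.+ ½ ℚ.* ε ≡ ε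
  half+half ε = trans (sym (ℚ.*-distribʳ-+ ε ½ ½)) (ℚ.*-identityˡ ε)

  *-pos : ∀ {p q} → 0ℚ ℚ.< p → 0ℚ ℚ.< q → 0ℚ ℚ.< p ℚ.* q
  *-pos {p} {q} 0<p 0<q =
    ℚ.positive⁻¹ (p ℚ.* q) {{ℚ.pos*pos⇒pos p {{ℚ.positive 0<p}} q {{ℚ.positive 0<q}}}}

  half-pos : ∀ {ε} → 0ℚ ℚ.< ε → 0ℚ ℚ.< ½ ℚ.* ε
  half-pos = *-pos (ℚ.positive⁻¹ ½)

  ∣p∣<ε : ∀ {p ε} → p ℚ.< ε → ℚ.- p ℚ.< ε → ℚ.∣ p ∣ ℚ.< ε
  ∣p∣<ε {p} {ε} p<ε -p<ε with ℚ.∣p∣≡p∨∣p∣≡-p p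
  ... | inj₁ eq = subst (ℚ._< ε) (sym eq) p<ε
  ... | inj₂ eq = subst (ℚ._< ε) (sym eq) -p<ε

  ∣ab∣<Bδ : ∀ {a b B δ} → 0ℚ ℚ.< B → ℚ.∣ a ∣ ℚ.< B → ℚ.∣ b ∣ ℚ.< δ → ℚ.∣ a ℚ.* b ∣ ℚ.< B ℚ.* δ
  ∣ab∣<Bδ {a} {b} {B} {δ} 0<B a<B b<δ = begin-strict
    ℚ.∣ a ℚ.* b ∣         ≡⟨ ℚ.∣p*q∣≡∣p∣*∣q∣ a b ⟩
    ℚ.∣ a ∣ ℚ.* ℚ.∣ b ∣   ≤⟨ ℚ.*-monoʳ-≤-nonNeg ℚ.∣ b ∣ {{ℚ.∣-∣-nonNeg b}} (ℚ.<⇒≤ a<B) ⟩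
    B ℚ.* ℚ.∣ b ∣         <⟨ ℚ.*-monoʳ-<-pos B {{ℚ.positive 0<B}} b<δ ⟩
    B ℚ.* δ               ∎
    where open ℚ.≤-Reasoning

  /-mono-< : ∀ a b c d → a ℕ.* suc d ℕ.< c ℕ.* suc b → + a ℚ./ suc b ℚ.< + c ℚ./ suc d
  /-mono-< a b c d lt = ℚ.toℚᵘ-cancel-<
    (ℚᵘ.<-respˡ-≃ (ℚᵘ.≃-sym (ℚ.toℚᵘ-fromℚᵘ (ℚᵘ.mkℚᵘ (+ a) b)))
      (ℚᵘ.<-respʳ-≃ (ℚᵘ.≃-sym (ℚ.toℚᵘ-fromℚᵘ (ℚᵘ.mkℚᵘ (+ c) d)))
        (ℚᵘ.*<* (subst₂ ℤ._<_ (ℤ.pos-* a (suc d)) (ℤ.pos-* c (suc b)) (ℤ.+<+ lt)))))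

  /-mono-≤ : ∀ a b c d → a ℕ.* suc d ℕ.≤ c ℕ.* suc b → + a ℚ./ suc b ℚ.≤ + c ℚ./ suc d
  /-mono-≤ a b c d le = ℚ.toℚᵘ-cancel-≤
    (ℚᵘ.≤-respˡ-≃ (ℚᵘ.≃-sym (ℚ.toℚᵘ-fromℚᵘ (ℚᵘ.mkℚᵘ (+ a) b)))
      (ℚᵘ.≤-respʳ-≃ (ℚᵘ.≃-sym (ℚ.toℚᵘ-fromℚᵘ (ℚᵘ.mkℚᵘ (+ c) d)))
        (ℚᵘ.*≤* (subst₂ ℤ._≤_ (ℤ.pos-* a (suc d)) (ℤ.pos-* c (suc b)) (ℤ.+≤+ le)))))

  /-suc : ∀ a d → + suc a ℚ./ suc d ≡ + a ℚ./ suc d ℚ.+ + 1 ℚ./ suc d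
  /-suc a d = ℚ.toℚᵘ-injective
    (ℚᵘ.≃-trans (ℚ.toℚᵘ-fromℚᵘ (ℚᵘ.mkℚᵘ (+ suc a) d))
    (ℚᵘ.≃-trans eq
    (ℚᵘ.≃-trans (ℚᵘ.≃-sym (ℚᵘ.+-cong (ℚ.toℚᵘ-fromℚᵘ (ℚᵘ.mkℚᵘ (+ a) d)) (ℚ.toℚᵘ-fromℚᵘ (ℚᵘ.mkℚᵘ (+ 1) d))))
      (ℚᵘ.≃-sym (ℚ.toℚᵘ-homo-+ (+ a ℚ./ suc d) (+ 1 ℚ./ suc d))))))
    where
    D : ℕ
    D = suc d
    eq : ℚᵘ.mkℚᵘ (+ suc a) d ℚᵘ.≃ ℚᵘ.mkℚᵘ (+ a) d ℚᵘ.+ ℚᵘ.mkℚᵘ (+ 1) d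
    eq = ℚᵘ.*≡* (trans (sym (ℤ.pos-* (suc a) (D ℕ.* D))) (trans (cong +_ (suc-arith a D))
      (trans (ℤ.pos-* (a ℕ.* D ℕ.+ 1 ℕ.* D) D)
        (cong (ℤ._* + D) (cong₂ ℤ._+_ (ℤ.pos-* a D) (ℤ.pos-* 1 D))))))

  archimedean : ∀ {ε} → 0ℚ ℚ.< ε → ∃[ N ] ∀ n → N ℕ.≤ n → + 1 ℚ./ suc n ℚ.< ε
  archimedean {ε@(mkℚ +[1+ p ] d _)} _ = suc d , λ n d<n →
    subst (+ 1 ℚ./ suc n ℚ.<_) (ℚ.↥p/↧p≡p ε)
      (/-mono-< 1 n (suc p) d
        (ℕ.<-≤-trans (subst (ℕ._< suc n) (sym (ℕ.*-identityˡ (suc d))) (s≤s d<n)) (ℕ.m≤m+n (suc n) (p ℕ.* suc n))))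
  archimedean {mkℚ (+ 0) _ _} (ℚ.*<* (ℤ.+<+ ()))
  archimedean {mkℚ ℤ.-[1+ _ ] _ _} (ℚ.*<* ())

-- Real numbers as Cauchy sequences of rationals.  ℝ is a setoid: the
-- equality of reals is _≈_, and all operations act termwise.

IsCauchy : (ℕ → ℚ) → Set
IsCauchy x = ∀ ε → 0ℚ ℚ.< ε → ∃[ N ] ∀ i j → N ℕ.≤ i → N ℕ.≤ j → ℚ.∣ x i ℚ.- x j ∣ ℚ.< ε

record ℝ : Set where
  constructor mkℝ
  field
    seq    : ℕ → ℚ
    cauchy : IsCauchy seq

open ℝ public

infix 4 _≈_

_≈_ : Rel ℝ 0ℓ
x ≈ y = ∀ ε → 0ℚ ℚ.< ε → ∃[ N ] ∀ i → N ℕ.≤ i → ℚ.∣ seq x i ℚ.- seq y i ∣ ℚ.< ε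

abstract
  eventuallyBounded : ∀ (x : ℝ) →
    Σ[ B ∈ ℚ ] 0ℚ ℚ.< B × (∃[ N ] ∀ i → N ℕ.≤ i → ℚ.∣ seq x i ∣ ℚ.< B)
  eventuallyBounded x with cauchy x 1ℚ (ℚ.positive⁻¹ 1ℚ)
  ... | N , close = 1ℚ ℚ.+ ℚ.∣ seq x N ∣ , 0<B , N , λ i N≤i →
    subst (λ p → ℚ.∣ p ∣ ℚ.< 1ℚ ℚ.+ ℚ.∣ seq x N ∣) (telescope (seq x i) (seq x N))
      (ℚ.≤-<-trans (ℚ.∣p+q∣≤∣p∣+∣q∣ (seq x i ℚ.- seq x N) (seq x N))
        (ℚ.+-monoˡ-< ℚ.∣ seq x N ∣ (close i N N≤i ℕ.≤-refl)))
    where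
    0<B : 0ℚ ℚ.< 1ℚ ℚ.+ ℚ.∣ seq x N ∣
    0<B = ℚ.+-mono-<-≤ (ℚ.positive⁻¹ 1ℚ) (ℚ.0≤∣p∣ (seq x N))

  const-cauchy : ∀ p → IsCauchy (λ _ → p)
  const-cauchy p ε 0<ε = 0 , λ _ _ _ _ →
    subst (λ q → ℚ.∣ q ∣ ℚ.< ε) (sym (ℚ.+-inverseʳ p)) 0<ε

  +-cauchy : ∀ x y → IsCauchy (λ i → seq x i ℚ.+ seq y i)
  +-cauchy x y ε 0<ε with cauchy x (½ ℚ.* ε) (half-pos 0<ε) | cauchy y (½ ℚ.* ε) (half-pos 0<ε)
  ... | M , closeˣ | N , closeʸ = M ⊔ N , λ i j i≥ j≥ →
    subst₂ (λ p q → ℚ.∣ p ∣ ℚ.< q) (regroup (seq x i) (seq x j) (seq y i) (seq y j)) (half+half ε)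
      (triangle (closeˣ i j (ℕ.m⊔n≤o⇒m≤o M N i≥) (ℕ.m⊔n≤o⇒m≤o M N j≥))
                (closeʸ i j (ℕ.m⊔n≤o⇒n≤o M N i≥) (ℕ.m⊔n≤o⇒n≤o M N j≥)))

  neg-cauchy : ∀ x → IsCauchy (λ i → ℚ.- seq x i)
  neg-cauchy x ε 0<ε with cauchy x ε 0<ε
  ... | N , close = N , λ i j i≥ j≥ →
    subst (λ p → ℚ.∣ p ∣ ℚ.< ε) (neg-flip′ (seq x i) (seq x j)) (close j i j≥ i≥)

  shrink : ∀ {C ε} → 0ℚ ℚ.< C → 0ℚ ℚ.< ε → Σ[ δ ∈ ℚ ] 0ℚ ℚ.< δ × C ℚ.* δ ≡ ε
  shrink {C} {ε} 0<C 0<ε = 1/C ℚ.* ε , *-pos (ℚ.positive⁻¹ 1/C {{ℚ.1/pos⇒pos C}}) 0<ε ,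
    trans (sym (ℚ.*-assoc C 1/C ε))
      (trans (cong (ℚ._* ε) (ℚ.*-inverseʳ C)) (ℚ.*-identityˡ ε))
    where
    instance
      C-pos : ℚ.Positive C
      C-pos = ℚ.positive 0<C
      C-nonZero : ℚ.NonZero C
      C-nonZero = ℚ.pos⇒nonZero C
    1/C : ℚ
    1/C = ℚ.1/ C

  commonBound : ∀ {A B} → 0ℚ ℚ.< A → 0ℚ ℚ.< B → Σ[ C ∈ ℚ ] 0ℚ ℚ.< C × A ℚ.< C × B ℚ.< C
  commonBound {A} {B} 0<A 0<B = A ℚ.+ B , ℚ.+-mono-< 0<A 0<B ,
    subst (ℚ._< A ℚ.+ B) (ℚ.+-identityʳ A) (ℚ.+-monoʳ-< A 0<B) ,
    subst (ℚ._< A ℚ.+ B) (ℚ.+-identityˡ B) (ℚ.+-monoˡ-< B 0<A)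

  *-close : ∀ {a a′ b b′ C δ ε} → 0ℚ ℚ.< C → C ℚ.* δ ≡ ½ ℚ.* ε → ℚ.∣ a ∣ ℚ.< C → ℚ.∣ b′ ∣ ℚ.< C →
            ℚ.∣ a ℚ.- a′ ∣ ℚ.< δ → ℚ.∣ b ℚ.- b′ ∣ ℚ.< δ → ℚ.∣ a ℚ.* b ℚ.- a′ ℚ.* b′ ∣ ℚ.< ε
  *-close {a} {a′} {b} {b′} {C} {δ} {ε} 0<C Cδ≡½ε a<C b′<C a-a′ b-b′ = begin-strict
    ℚ.∣ a ℚ.* b ℚ.- a′ ℚ.* b′ ∣                       ≡⟨ cong ℚ.∣_∣ (split a a′ b b′) ⟨
    ℚ.∣ a ℚ.* (b ℚ.- b′) ℚ.+ b′ ℚ.* (a ℚ.- a′) ∣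
      <⟨ triangle {a ℚ.* (b ℚ.- b′)} {b′ ℚ.* (a ℚ.- a′)}
           (∣ab∣<Bδ {a} {b ℚ.- b′} 0<C a<C b-b′) (∣ab∣<Bδ {b′} {a ℚ.- a′} 0<C b′<C a-a′) ⟩
    C ℚ.* δ ℚ.+ C ℚ.* δ                               ≡⟨ cong₂ ℚ._+_ Cδ≡½ε Cδ≡½ε ⟩
    ½ ℚ.* ε ℚ.+ ½ ℚ.* ε                               ≡⟨ half+half ε ⟩
    ε                                                 ∎
    where open ℚ.≤-Reasoning

  *-cauchy : ∀ x y → IsCauchy (λ i → seq x i ℚ.* seq y i)
  *-cauchy x y ε 0<ε =
    let A , 0<A , K , boundˣ = eventuallyBounded x
        B , 0<B , L , boundʸ = eventuallyBounded y
        C , 0<C , A<C , B<C  = commonBound 0<A 0<B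
        δ , 0<δ , Cδ≡½ε      = shrink 0<C (half-pos 0<ε)
        M , closeˣ           = cauchy x δ 0<δ
        N , closeʸ           = cauchy y δ 0<δ
    in (K ⊔ L) ⊔ (M ⊔ N) , λ i j i≥ j≥ →
      let i≥₁ = ℕ.m⊔n≤o⇒m≤o (K ⊔ L) (M ⊔ N) i≥
          j≥₁ = ℕ.m⊔n≤o⇒m≤o (K ⊔ L) (M ⊔ N) j≥
          i≥₂ = ℕ.m⊔n≤o⇒n≤o (K ⊔ L) (M ⊔ N) i≥
          j≥₂ = ℕ.m⊔n≤o⇒n≤o (K ⊔ L) (M ⊔ N) j≥
      in *-close {seq x i} {seq x j} {seq y i} {seq y j} 0<C Cδ≡½ε
           (ℚ.<-trans (boundˣ i (ℕ.m⊔n≤o⇒m≤o K L i≥₁)) A<C)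
           (ℚ.<-trans (boundʸ j (ℕ.m⊔n≤o⇒n≤o K L j≥₁)) B<C)
           (closeˣ i j (ℕ.m⊔n≤o⇒m≤o M N i≥₂) (ℕ.m⊔n≤o⇒m≤o M N j≥₂))
           (closeʸ i j (ℕ.m⊔n≤o⇒n≤o M N i≥₂) (ℕ.m⊔n≤o⇒n≤o M N j≥₂))

  abs-cauchy : ∀ x → IsCauchy (λ i → ℚ.∣ seq x i ∣)
  abs-cauchy x ε 0<ε with cauchy x ε 0<ε
  ... | N , close = N , λ i j i≥ j≥ →
    ∣p∣<ε (ℚ.≤-<-trans (reverse-triangle (seq x i) (seq x j)) (close i j i≥ j≥))
          (subst (ℚ._< ε) (neg-flip ℚ.∣ seq x i ∣ ℚ.∣ seq x j ∣)
            (ℚ.≤-<-trans (reverse-triangle (seq x j) (seq x i)) (close j i j≥ i≥)))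
    where
    reverse-triangle : ∀ a b → ℚ.∣ a ∣ ℚ.- ℚ.∣ b ∣ ℚ.≤ ℚ.∣ a ℚ.- b ∣
    reverse-triangle a b = subst₂ (λ p q → ℚ.∣ p ∣ ℚ.- ℚ.∣ b ∣ ℚ.≤ q) (telescope a b)
      (+-cancel ℚ.∣ a ℚ.- b ∣ ℚ.∣ b ∣)
      (ℚ.+-monoˡ-≤ (ℚ.- ℚ.∣ b ∣) (ℚ.∣p+q∣≤∣p∣+∣q∣ (a ℚ.- b) b))

fromℚ : ℚ → ℝ
fromℚ p = mkℝ (λ _ → p) (const-cauchy p)

fromℕ : ℕ → ℝ
fromℕ n = fromℚ (+ n ℚ./ 1)

0ℝ 1ℝ : ℝ
0ℝ = fromℚ 0ℚ
1ℝ = fromℚ 1ℚ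

infixl 6 _+_ _-_
infixl 7 _*_
infix  8 -_

_+_ : ℝ → ℝ → ℝ
x + y = mkℝ (λ i → seq x i ℚ.+ seq y i) (+-cauchy x y)

_*_ : ℝ → ℝ → ℝ
x * y = mkℝ (λ i → seq x i ℚ.* seq y i) (*-cauchy x y)

-_ : ℝ → ℝ
- x = mkℝ (λ i → ℚ.- seq x i) (neg-cauchy x)

_-_ : ℝ → ℝ → ℝ
x - y = x + - y

∣_∣ : ℝ → ℝ
∣ x ∣ = mkℝ (λ i → ℚ.∣ seq x i ∣) (abs-cauchy x)

ℝ-rawRing : RawRing 0ℓ 0ℓ
ℝ-rawRing = record
  { Carrier = ℝ ; _≈_ = _≈_ ; _+_ = _+_ ; _*_ = _*_ ; -_ = -_ ; 0# = 0ℝ ; 1# = 1ℝ }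

open import Algebra.Definitions.RawSemiring (RawRing.rawSemiring ℝ-rawRing) public
  using (_^_; sum; product)

-- x is apart from zero: eventually bounded away from 0.
_#0 : ℝ → Set
x #0 = Σ[ c ∈ ℚ ] 0ℚ ℚ.< c × (∃[ N ] ∀ i → N ℕ.≤ i → c ℚ.≤ ℚ.∣ seq x i ∣)

-- The value at 0 is immaterial: if x #0 then only finitely many terms
-- of x vanish.
recip : ℚ → ℚ
recip p with p ℚ.≟ 0ℚ
... | yes _   = 0ℚ
... | no  p≢0 = (ℚ.1/ p) {{ℚ.≢-nonZero p≢0}}

recip-inverse : ∀ {p} → p ≢ 0ℚ → p ℚ.* recip p ≡ 1ℚ
recip-inverse {p} p≢0 with p ℚ.≟ 0ℚ
... | yes p≡0 = contradiction p≡0 p≢0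
... | no  p≢0 = ℚ.*-inverseʳ p {{ℚ.≢-nonZero p≢0}}

abstract
  away⇒≢0 : ∀ {c p} → 0ℚ ℚ.< c → c ℚ.≤ ℚ.∣ p ∣ → p ≢ 0ℚ
  away⇒≢0 0<c c≤0 refl = ℚ.<-irrefl refl (ℚ.<-≤-trans 0<c c≤0)

  inv-cauchy : ∀ x → x #0 → IsCauchy (λ i → recip (seq x i))
  inv-cauchy x (c , 0<c , M , away) ε 0<ε
    with cauchy x (c ℚ.* c ℚ.* ε) (*-pos (*-pos 0<c 0<c) 0<ε)
  ... | N , close = M ⊔ N , λ i j i≥ j≥ →
    bound (away i (ℕ.m⊔n≤o⇒m≤o M N i≥)) (away j (ℕ.m⊔n≤o⇒m≤o M N j≥))
      (close j i (ℕ.m⊔n≤o⇒n≤o M N j≥) (ℕ.m⊔n≤o⇒n≤o M N i≥))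
    where
    factor : ∀ a b u v → b ℚ.* v ≡ 1ℚ → a ℚ.* u ≡ 1ℚ → u ℚ.- v ≡ (b ℚ.- a) ℚ.* (u ℚ.* v)
    factor a b u v bv au = trans
      (sym (trans (cong₂ (λ p q → u ℚ.* p ℚ.- v ℚ.* q) bv au)
        (cong₂ ℚ._-_ (ℚ.*-identityʳ u) (ℚ.*-identityʳ v))))
      (expand a b u v)
    instance
      c-pos : ℚ.Positive c
      c-pos = ℚ.positive 0<c
    bound : ∀ {a b} → c ℚ.≤ ℚ.∣ a ∣ → c ℚ.≤ ℚ.∣ b ∣ → ℚ.∣ b ℚ.- a ∣ ℚ.< c ℚ.* c ℚ.* ε →
            ℚ.∣ recip a ℚ.- recip b ∣ ℚ.< ε
    bound {a} {b} c≤a c≤b d< =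
      ℚ.*-cancelˡ-<-nonNeg (c ℚ.* c) {{ℚ.pos⇒nonNeg (c ℚ.* c) {{ℚ.pos*pos⇒pos c c}}}} (begin-strict
        (c ℚ.* c) ℚ.* ℚ.∣ u ℚ.- v ∣ ≡⟨ cong ((c ℚ.* c) ℚ.*_) eq ⟩
        (c ℚ.* c) ℚ.* (D ℚ.* (U ℚ.* V)) ≡⟨ rearrange c D U V ⟩
        D ℚ.* ((c ℚ.* U) ℚ.* (c ℚ.* V)) ≤⟨ ℚ.*-monoˡ-≤-nonNeg D {{ℚ.∣-∣-nonNeg (b ℚ.- a)}} le ⟩
        D ℚ.* 1ℚ ≡⟨ ℚ.*-identityʳ D ⟩
        D <⟨ d< ⟩
        c ℚ.* c ℚ.* ε ∎)
      where
      open ℚ.≤-Reasoning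
      u v U V D : ℚ
      u = recip a
      v = recip b
      U = ℚ.∣ u ∣
      V = ℚ.∣ v ∣
      D = ℚ.∣ b ℚ.- a ∣
      au : a ℚ.* u ≡ 1ℚ
      au = recip-inverse (away⇒≢0 0<c c≤a)
      bv : b ℚ.* v ≡ 1ℚ
      bv = recip-inverse (away⇒≢0 0<c c≤b)
      eq : ℚ.∣ u ℚ.- v ∣ ≡ D ℚ.* (U ℚ.* V)
      eq = trans (cong ℚ.∣_∣ (factor a b u v bv au))
        (trans (ℚ.∣p*q∣≡∣p∣*∣q∣ (b ℚ.- a) (u ℚ.* v)) (cong (D ℚ.*_) (ℚ.∣p*q∣≡∣p∣*∣q∣ u v)))
      le1 : ∀ {p q} → c ℚ.≤ ℚ.∣ p ∣ → p ℚ.* q ≡ 1ℚ → c ℚ.* ℚ.∣ q ∣ ℚ.≤ 1ℚ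
      le1 {p} {q} c≤p pq = subst (c ℚ.* ℚ.∣ q ∣ ℚ.≤_) (trans (sym (ℚ.∣p*q∣≡∣p∣*∣q∣ p q)) (cong ℚ.∣_∣ pq))
        (ℚ.*-monoʳ-≤-nonNeg ℚ.∣ q ∣ {{ℚ.∣-∣-nonNeg q}} c≤p)
      le : (c ℚ.* U) ℚ.* (c ℚ.* V) ℚ.≤ 1ℚ
      le = ℚ.≤-trans
        (ℚ.*-monoʳ-≤-nonNeg (c ℚ.* V) {{ℚ.nonNeg*nonNeg⇒nonNeg c {{ℚ.pos⇒nonNeg c}} V {{ℚ.∣-∣-nonNeg v}}}} (le1 c≤a au))
        (subst (ℚ._≤ 1ℚ) (sym (ℚ.*-identityˡ (c ℚ.* V))) (le1 c≤b bv))

inv : (x : ℝ) → x #0 → ℝ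
inv x x#0 = mkℝ (λ i → recip (seq x i)) (inv-cauchy x x#0)

*-inv : ∀ x (x#0 : x #0) → x * inv x x#0 ≈ 1ℝ
*-inv x (c , 0<c , N , away) ε 0<ε = N , λ i N≤i →
  subst (λ p → ℚ.∣ p ℚ.- 1ℚ ∣ ℚ.< ε) (sym (recip-inverse (away⇒≢0 0<c (away i N≤i)))) 0<ε

bump : ℕ → ℕ → ℕ
bump k r with suc r ℕ.* suc r ℕ.≤? k
... | yes _ = suc r
... | no  _ = r

-- The integer part of the square root.
isqrt : ℕ → ℕ
isqrt zero    = 0
isqrt (suc k) = bump (suc k) (isqrt k)

isqrt-lower : ∀ k → isqrt k ℕ.* isqrt k ℕ.≤ k
isqrt-lower zero = z≤n
isqrt-lower (suc k) with suc (isqrt k) ℕ.* suc (isqrt k) ℕ.≤? suc k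
... | yes le = le
... | no  _  = ℕ.m≤n⇒m≤1+n (isqrt-lower k)

isqrt-upper : ∀ k → k ℕ.< suc (isqrt k) ℕ.* suc (isqrt k)
isqrt-upper zero = s≤s z≤n
isqrt-upper (suc k) with suc (isqrt k) ℕ.* suc (isqrt k) ℕ.≤? suc k
... | yes _  = ℕ.≤-<-trans (isqrt-upper k) (ℕ.*-mono-< (ℕ.n<1+n (suc (isqrt k))) (ℕ.n<1+n (suc (isqrt k))))
... | no ¬le = ℕ.≰⇒> ¬le

scaled : ℕ → ℕ → ℕ
scaled k i = isqrt (k ℕ.* (suc i ℕ.* suc i))

-- The i-th approximation to √k is ⌊√k·(i+1)⌋/(i+1).
√-seq : ℕ → ℕ → ℚ
√-seq k i = + scaled k i ℚ./ suc i

abstract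
  square-cancel-< : ∀ {a b} → a ℕ.* a ℕ.< b ℕ.* b → a ℕ.< b
  square-cancel-< {a} {b} lt with a ℕ.<? b
  ... | yes a<b = a<b
  ... | no  a≮b = contradiction lt (ℕ.≤⇒≯ (ℕ.*-mono-≤ (ℕ.≮⇒≥ a≮b) (ℕ.≮⇒≥ a≮b)))

  √-step : ∀ k i j → √-seq k i ℚ.< √-seq k j ℚ.+ + 1 ℚ./ suc j
  √-step k i j = subst (√-seq k i ℚ.<_) (/-suc (scaled k j) j)
    (/-mono-< (scaled k i) i (suc (scaled k j)) j (square-cancel-< (begin-strict
      (s ℕ.* J) ℕ.* (s ℕ.* J)               ≡⟨ *-swap s J ⟩
      (s ℕ.* s) ℕ.* (J ℕ.* J)               ≤⟨ ℕ.*-monoˡ-≤ (J ℕ.* J) (isqrt-lower (k ℕ.* (I ℕ.* I))) ⟩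
      (k ℕ.* (I ℕ.* I)) ℕ.* (J ℕ.* J)       ≡⟨ *-swap′ k (I ℕ.* I) (J ℕ.* J) ⟩
      (k ℕ.* (J ℕ.* J)) ℕ.* (I ℕ.* I)       <⟨ ℕ.*-monoˡ-< (I ℕ.* I) (isqrt-upper (k ℕ.* (J ℕ.* J))) ⟩
      (t ℕ.* t) ℕ.* (I ℕ.* I)               ≡⟨ *-swap t I ⟨
      (t ℕ.* I) ℕ.* (t ℕ.* I)               ∎)))
    where
    open ℕ.≤-Reasoning
    I J s t : ℕ
    I = suc i
    J = suc j
    s = scaled k i
    t = suc (scaled k j)

  √-cauchy : ∀ k → IsCauchy (√-seq k)
  √-cauchy k ε 0<ε with archimedean 0<ε
  ... | N , small = N , λ i j i≥ j≥ →
    ∣p∣<ε (ℚ.<-trans (diff (√-step k i j)) (small j j≥))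
          (subst (ℚ._< ε) (neg-flip (√-seq k i) (√-seq k j)) (ℚ.<-trans (diff (√-step k j i)) (small i i≥)))
    where
    diff : ∀ {a b e} → a ℚ.< b ℚ.+ e → a ℚ.- b ℚ.< e
    diff {a} {b} {e} lt = subst (a ℚ.- b ℚ.<_) (trans (cong (ℚ._- b) (ℚ.+-comm b e)) (+-cancel e b))
      (ℚ.+-monoˡ-< (ℚ.- b) lt)

√_ : ℕ → ℝ
√ k = mkℝ (√-seq k) (√-cauchy k)

abstract
  √-#0 : ∀ k → .{{NonZero k}} → (√ k) #0
  √-#0 k = 1ℚ , ℚ.positive⁻¹ 1ℚ , 0 , λ i _ →
    subst (1ℚ ℚ.≤_) (sym (ℚ.0≤p⇒∣p∣≡p {√-seq k i} (0≤√ i))) (1≤√ i)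
    where
    1≤√ : ∀ i → 1ℚ ℚ.≤ √-seq k i
    1≤√ i = /-mono-≤ 1 0 (scaled k i) i
      (subst₂ ℕ._≤_ (sym (ℕ.*-identityˡ (suc i))) (sym (ℕ.*-identityʳ (scaled k i)))
        (ℕ.≤-pred (square-cancel-< (ℕ.≤-<-trans (ℕ.m≤n*m (suc i ℕ.* suc i) k)
          (isqrt-upper (k ℕ.* (suc i ℕ.* suc i)))))))
    0≤√ : ∀ i → 0ℚ ℚ.≤ √-seq k i
    0≤√ i = ℚ.≤-trans (ℚ.nonNegative⁻¹ 1ℚ) (1≤√ i)

1/√_ : ∀ k → .{{NonZero k}} → ℝ
1/√ k = inv (√ k) (√-#0 k)

Matrix : ℕ → Set
Matrix n = Fin n → Fin n → ℝ

scalar : ∀ {n} → ℝ → Matrix n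
scalar x i j with i ≟ j
... | yes _ = x
... | no  _ = 0ℝ

infixl 6 _-ᴹ_

_-ᴹ_ : ∀ {n} → Matrix n → Matrix n → Matrix n
(A -ᴹ B) i j = A i j - B i j

-- Cofactor expansion along the first row.
det : ∀ {n} → Matrix n → ℝ
det {zero}  A = 1ℝ
det {suc n} A = sum λ j → (- 1ℝ) ^ toℕ j * (A zero j * det λ i k → A (suc i) (punchIn j k))

charPoly : ∀ {n} → Matrix n → ℝ → ℝ
charPoly A x = det (scalar x -ᴹ A)

-- ρ lists the eigenvalues of A with multiplicity, i.e. the roots of
-- the characteristic polynomial.  Real polynomials are identified with
-- the functions ℝ → ℝ they define.
IsSpectrum : ∀ {n} → Matrix n → Vector ℝ n → Set
IsSpectrum A ρ = ∀ x → charPoly A x ≈ product λ i → x - ρ i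

record Graph (N : ℕ) : Set₁ where
  field
    Adj    : Rel (Fin N) 0ℓ
    adj?   : Decidable Adj
    symm   : Symmetric Adj
    irrefl : Irreflexive _≡_ Adj

  degree : Fin N → ℕ
  degree i = length (filter (adj? i) (allFin N))

  degree-nonZero : ∀ {i j} → Adj i j → NonZero (degree i)
  degree-nonZero {i} {j} a = inhabited (∈-filter⁺ (adj? i) (∈-allFin j) a)
    where
    inhabited : ∀ {xs : List (Fin N)} → j ∈ xs → NonZero (length xs)
    inhabited (here _)  = _
    inhabited (there _) = _

open Graph

randićMatrix : ∀ {N} → Graph N → Matrix N
randićMatrix G i j with adj? G i j
... | no  _ = 0ℝ
... | yes a = (1/√ (degree G i ℕ.* degree G j)) {{nonZero}}
  where
  nonZero : NonZero (degree G i ℕ.* degree G j)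
  nonZero = ℕ.m*n≢0 (degree G i) (degree G j) {{degree-nonZero G a}} {{degree-nonZero G (symm G a)}}

RP : ∀ {N} → Graph N → ℝ → ℝ
RP G x = charPoly (randićMatrix G) x

-- A real symmetric matrix has a spectrum, unique up to order, so the
-- Randić energy is a function of the graph; here it is given as the
-- relation "e is the Randić energy of G".
record IsRandićEnergy {N} (G : Graph N) (e : ℝ) : Set where
  field
    spectrum   : Vector ℝ N
    isSpectrum : IsSpectrum (randićMatrix G) spectrum
    energy     : ∀ ρ → IsSpectrum (randićMatrix G) ρ → sum (λ i → ∣ ρ i ∣) ≈ e

-- Opposite parts of the disjoint union of the two colour classes.
Opposite : ∀ {a b} {A : Set a} {B : Set b} → Rel (A ⊎ B) 0ℓ
Opposite (inj₁ _) (inj₂ _) = ⊤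
Opposite (inj₂ _) (inj₁ _) = ⊤
Opposite (inj₁ _) (inj₁ _) = ⊥
Opposite (inj₂ _) (inj₂ _) = ⊥

opposite? : ∀ {a b} {A : Set a} {B : Set b} → Decidable (Opposite {A = A} {B = B})
opposite? (inj₁ _) (inj₂ _) = yes tt
opposite? (inj₂ _) (inj₁ _) = yes tt
opposite? (inj₁ _) (inj₁ _) = no λ ()
opposite? (inj₂ _) (inj₂ _) = no λ ()

opposite-sym : ∀ {a b} {A : Set a} {B : Set b} → Symmetric (Opposite {A = A} {B = B})
opposite-sym {x = inj₁ _} {y = inj₂ _} _ = tt
opposite-sym {x = inj₂ _} {y = inj₁ _} _ = tt

opposite-irrefl : ∀ {a b} {A : Set a} {B : Set b} (x : A ⊎ B) → ¬ Opposite x x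
opposite-irrefl (inj₁ _) ()
opposite-irrefl (inj₂ _) ()

-- The first m vertices form one part, the last n the other.
K : (m n : ℕ) → Graph (m ℕ.+ n)
K m n = record
  { Adj    = λ i j → Opposite (splitAt m i) (splitAt m j)
  ; adj?   = λ i j → opposite? (splitAt m i) (splitAt m j)
  ; symm   = λ {i} {j} → opposite-sym {x = splitAt m i} {y = splitAt m j}
  ; irrefl = λ { {i} refl → opposite-irrefl (splitAt m i) }
  }

{-# OPTIONS --safe #-}

-- The matrix [[xI, yJ], [yJ, xI + zJ]] with an m × m upper left block is treated
-- by writing its first row as (x − y)e₀ + y(1, 0, …, 0 | 1, …, 1).  Pivoting on the
-- leading 1 of the second summand only replaces z by z − y, so the determinant
-- satisfies D(m+1, z) = (x − y) D(m, z) + y D(m, z − y), without any division by x.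
--
-- Equality of Cauchy reals is ¬¬-stable, so the energy may be computed classically:
-- every ρᵢ is a root of xᵏ(x² − 1), hence 0, 1 or −1, and if these values occur
-- a, b and c times, then evaluating at x = 2 gives 2ᵃ·3ᶜ = 2ᵏ·3.  Hence a = k and
-- ∑ |ρᵢ| = b + c = 2.

module Submission where

open import Algebra.Bundles using (CommutativeRing; Semiring)
import Algebra.Solver.Ring.NaturalCoefficients.Default
open import Data.Fin.Base as Fin using (Fin; zero; suc; toℕ; splitAt; punchIn; punchOut; inject₁)
open import Data.Fin.Induction using (<-weakInduction)
import Data.Fin.Properties as Fin
open import Data.Integer.Base as ℤ using (+_)
import Data.Integer.Properties as ℤ
open import Data.List.Base using (_∷_; _++_; length; filter; tabulate)
import Data.List.Properties as List
import Data.List.Relation.Unary.All.Properties as All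
open import Data.Nat.Base as ℕ using (ℕ; zero; suc; NonZero; _⊔_; s≤s; z≤n)
open import Data.Nat.Divisibility using (_∣_; divides; ∣⇒≤)
open import Data.Nat.Primality using (Prime; prime?; euclidsLemma)
import Data.Nat.Properties as ℕ
import Data.Nat.Tactic.RingSolver as ℕ
open import Data.Product using (∃-syntax; _×_; _,_; proj₁; proj₂)
open import Data.Rational.Base as ℚ using (ℚ; 0ℚ; 1ℚ; ½)
import Data.Rational.Properties as ℚ
import Data.Rational.Unnormalised.Base as ℚᵘ
import Data.Rational.Unnormalised.Properties as ℚᵘ
open import Data.Sum.Base as Sum using (_⊎_; inj₁; inj₂)
open import Data.Vec.Functional using (Vector)
open import Effect.Monad using (RawMonad)
open import Function.Base using (_∘_; id)
open import Level using (0ℓ)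
open import Relation.Binary.Definitions using (tri<; tri≈; tri>)
open import Relation.Binary.PropositionalEquality as ≡ using (_≡_; _≢_)
open import Relation.Nullary using (¬_; yes; no; contradiction)
open import Relation.Nullary.Decidable using (¬¬-excluded-middle; from-yes)
open import Relation.Nullary.Negation using (¬¬-Monad; ¬¬-map)
open import Tactic.RingSolver using (solve-∀)

-- Determinants over a commutative ring

-- The formula for the characteristic polynomial is needed at every Cauchy real `x`, and it is
-- undecidable whether such an `x` vanishes. The price is a multiple of the all-ones matrix in the
-- lower right block, which is why z occurs although the Randić matrix has z = 0. For z = 0 and y =
-- -1/√(mn) the identity mn·y² = 1 turns the quadratic factor of the determinant into x² - 1.
--
-- For the energy, a polynomial is known only through its values, so the multiplicities are
-- recovered arithmetically. The point x = 2 is chosen because x - v takes the values 2, 1 and 3 at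
-- v = 0, 1 and -1: a unit and two distinct primes, so that unique factorisation separates the zeros
-- from the rest.

punchIn-adjacent : ∀ {n} (j : Fin n) (l : Fin n) →
  punchIn (inject₁ j) l ≡ punchIn (suc j) l ⊎
  (punchIn (inject₁ j) l ≡ suc j × punchIn (suc j) l ≡ inject₁ j)
punchIn-adjacent zero    zero    = inj₂ (≡.refl , ≡.refl)
punchIn-adjacent zero    (suc l) = inj₁ ≡.refl
punchIn-adjacent (suc j) zero    = inj₁ ≡.refl
punchIn-adjacent (suc j) (suc l) with punchIn-adjacent j l
... | inj₁ eq        = inj₁ (≡.cong suc eq)
... | inj₂ (eq , e′) = inj₂ (≡.cong suc eq , ≡.cong suc e′)

-- Deleting a third column keeps two adjacent columns adjacent. This lets `det-adjacent-equal`
-- recurse into the minors that still contain both equal columns.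
punchIn-avoids-adjacent : ∀ {n} (k : Fin (suc (suc n))) (j : Fin (suc n)) → k ≢ inject₁ j → k ≢ suc j →
  ∃[ l ] punchIn k (inject₁ l) ≡ inject₁ j × punchIn k (suc l) ≡ suc j
punchIn-avoids-adjacent zero          zero    k≢j _     = contradiction ≡.refl k≢j
punchIn-avoids-adjacent zero          (suc j) _   _     = j , ≡.refl , ≡.refl
punchIn-avoids-adjacent (suc zero)    zero    _   k≢1+j = contradiction ≡.refl k≢1+j
punchIn-avoids-adjacent {suc n} (suc (suc k)) zero _ _  = zero , ≡.refl , ≡.refl
punchIn-avoids-adjacent {suc n} (suc k) (suc j) k≢j k≢1+j
  with punchIn-avoids-adjacent k j (k≢j ∘ ≡.cong suc) (k≢1+j ∘ ≡.cong suc)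
... | l , eq , e′ = suc l , ≡.cong suc eq , ≡.cong suc e′

inject₁≢suc : ∀ {n} (i : Fin n) → inject₁ i ≢ suc i
inject₁≢suc (suc i) eq = inject₁≢suc i (Fin.suc-injective eq)

module Determinant {c ℓ} (R : CommutativeRing c ℓ) where

  open CommutativeRing R hiding (zero)
  open import Algebra.Definitions.RawSemiring (Semiring.rawSemiring semiring) using (_^_)
  open import Algebra.Properties.CommutativeMonoid.Sum +-commutativeMonoid
    using (sum; sum-cong-≋; ∑-distrib-+; sum-replicate-zero)
  open import Algebra.Properties.Monoid.Mult +-monoid using () renaming (_×_ to _·_)
  open import Algebra.Properties.Ring (CommutativeRing.ring R) using (-1*x≈-x; -0#≈0#; +-inverseʳ-unique)
  open import Algebra.Properties.Semiring.Sum semiring using (*-distribˡ-sum)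
  open import Relation.Binary.Reasoning.Setoid setoid

  private module Solver = Algebra.Solver.Ring.NaturalCoefficients.Default commutativeSemiring
  open Solver using (solve; _:+_; _:*_; _:=_; con)

  Matrix : ℕ → Set c
  Matrix n = Fin n → Fin n → Carrier

  minor : ∀ {n} → Matrix (suc n) → Fin (suc n) → Matrix n
  minor A j i k = A (suc i) (punchIn j k)

  det : ∀ {n} → Matrix n → Carrier
  det {zero}  A = 1#
  det {suc n} A = sum λ j → (- 1#) ^ toℕ j * (A zero j * det (minor A j))

  det-cong : ∀ {n} {A B : Matrix n} → (∀ i j → A i j ≈ B i j) → det A ≈ det B
  det-cong {zero}  A≈B = refl
  det-cong {suc n} A≈B = sum-cong-≋ λ j →
    *-congˡ {(- 1#) ^ toℕ j} (*-cong (A≈B zero j) (det-cong λ i k → A≈B (suc i) (punchIn j k)))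

  sum≈0 : ∀ {n} {f : Vector Carrier n} → (∀ i → f i ≈ 0#) → sum f ≈ 0#
  sum≈0 {n} f≈0 = trans (sum-cong-≋ f≈0) (sum-replicate-zero n)

  sum-linear : ∀ {n} {f g h : Vector Carrier n} t → (∀ i → h i ≈ f i + t * g i) → sum h ≈ sum f + t * sum g
  sum-linear {f = f} {g} {h} t h≈ = begin
    sum h                          ≈⟨ sum-cong-≋ h≈ ⟩
    sum (λ i → f i + t * g i)      ≈⟨ ∑-distrib-+ f (λ i → t * g i) ⟩
    sum f + sum (λ i → t * g i)    ≈⟨ +-congˡ (*-distribˡ-sum t g) ⟨
    sum f + t * sum g              ∎

  -- Each cofactor term is linear for one of two reasons. If the deleted column is `j`, the minors
  -- agree and the entry is linear; otherwise the entries agree and the minor is linear in the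
  -- shifted column, by induction on the size.
  det-linear : ∀ {n} (j : Fin n) t {A B C : Matrix n} →
    (∀ i k → k ≢ j → A i k ≈ C i k) → (∀ i k → k ≢ j → B i k ≈ C i k) →
    (∀ i → C i j ≈ A i j + t * B i j) → det C ≈ det A + t * det B
  det-linear {suc n} j t {A} {B} {C} A≈C B≈C C≈A+tB = sum-linear t term
    where
    entry : ∀ s a b d t → s * ((a + t * b) * d) ≈ s * (a * d) + t * (s * (b * d))
    entry = solve 5 (λ s a b d t → s :* ((a :+ t :* b) :* d) := s :* (a :* d) :+ t :* (s :* (b :* d))) refl
    rest : ∀ s e a b t → s * (e * (a + t * b)) ≈ s * (e * a) + t * (s * (e * b))
    rest = solve 5 (λ s e a b t → s :* (e :* (a :+ t :* b)) := s :* (e :* a) :+ t :* (s :* (e :* b))) refl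
    term : ∀ k → (- 1#) ^ toℕ k * (C zero k * det (minor C k)) ≈
                 (- 1#) ^ toℕ k * (A zero k * det (minor A k)) + t * ((- 1#) ^ toℕ k * (B zero k * det (minor B k)))
    term k with k Fin.≟ j
    ... | yes ≡.refl = begin
      s * (C zero k * det (minor C k))                           ≈⟨ *-congˡ (*-congʳ (C≈A+tB zero)) ⟩
      s * ((A zero k + t * B zero k) * det (minor C k))          ≈⟨ entry s (A zero k) (B zero k) _ t ⟩
      s * (A zero k * det (minor C k)) + t * (s * (B zero k * det (minor C k)))
        ≈⟨ +-cong (*-congˡ (*-congˡ (det-cong λ i l → A≈C (suc i) _ (Fin.punchInᵢ≢i k l))))
                  (*-congˡ (*-congˡ (*-congˡ (det-cong λ i l → B≈C (suc i) _ (Fin.punchInᵢ≢i k l))))) ⟨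
      s * (A zero k * det (minor A k)) + t * (s * (B zero k * det (minor B k))) ∎
      where s = (- 1#) ^ toℕ k
    ... | no k≢j = begin
      s * (C zero k * det (minor C k))
        ≈⟨ *-congˡ (*-congˡ (det-linear p t
             (λ i l l≢p → A≈C (suc i) _ (avoid l l≢p)) (λ i l l≢p → B≈C (suc i) _ (avoid l l≢p))
             (λ i → ≡.subst (λ q → C (suc i) q ≈ A (suc i) q + t * B (suc i) q) (≡.sym kp≡j) (C≈A+tB (suc i))))) ⟩
      s * (C zero k * (det (minor A k) + t * det (minor B k)))   ≈⟨ rest s (C zero k) _ _ t ⟩
      s * (C zero k * det (minor A k)) + t * (s * (C zero k * det (minor B k)))
        ≈⟨ +-cong (*-congˡ (*-congʳ (A≈C zero k k≢j))) (*-congˡ (*-congˡ (*-congʳ (B≈C zero k k≢j)))) ⟨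
      s * (A zero k * det (minor A k)) + t * (s * (B zero k * det (minor B k))) ∎
      where
      s = (- 1#) ^ toℕ k
      p = punchOut k≢j
      kp≡j : punchIn k p ≡ j
      kp≡j = Fin.punchIn-punchOut k≢j
      avoid : ∀ l → l ≢ p → punchIn k l ≢ j
      avoid l l≢p eq = l≢p (Fin.punchIn-injective k l p (≡.trans eq (≡.sym kp≡j)))

  sum-adjacent : ∀ {n} (f : Vector Carrier (suc n)) (j : Fin n) → f (inject₁ j) + f (suc j) ≈ 0# →
    (∀ k → k ≢ inject₁ j → k ≢ suc j → f k ≈ 0#) → sum f ≈ 0#
  sum-adjacent f zero cancel others = begin
    f zero + (f (suc zero) + sum (λ k → f (suc (suc k))))
      ≈⟨ +-assoc _ _ _ ⟨
    (f zero + f (suc zero)) + sum (λ k → f (suc (suc k)))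
      ≈⟨ +-cong cancel (sum≈0 λ k → others (suc (suc k)) (λ ()) (λ ())) ⟩
    0# + 0#  ≈⟨ +-identityˡ 0# ⟩
    0#       ∎
  sum-adjacent f (suc j) cancel others = begin
    f zero + sum (f ∘ suc)
      ≈⟨ +-cong (others zero (λ ()) (λ ())) (sum-adjacent (f ∘ suc) j cancel λ k k≢j k≢1+j →
           others (suc k) (k≢j ∘ Fin.suc-injective) (k≢1+j ∘ Fin.suc-injective)) ⟩
    0# + 0#  ≈⟨ +-identityˡ 0# ⟩
    0#       ∎

  -- The two terms that delete one of the equal columns have the same entry and minor but opposite
  -- signs; all other minors contain both columns and vanish by induction.
  det-adjacent-equal : ∀ {n} (j : Fin n) (A : Matrix (suc n)) →
    (∀ i → A i (inject₁ j) ≈ A i (suc j)) → det A ≈ 0#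
  det-adjacent-equal {suc n} j A eq = sum-adjacent _ j cancel others
    where
    opposite : ∀ s e → s * e + (- 1# * s) * e ≈ 0#
    opposite s e = begin
      s * e + (- 1# * s) * e  ≈⟨ +-congˡ (*-assoc (- 1#) s e) ⟩
      s * e + - 1# * (s * e)  ≈⟨ +-congˡ (-1*x≈-x (s * e)) ⟩
      s * e - s * e           ≈⟨ -‿inverseʳ (s * e) ⟩
      0#                      ∎
    -- Deleting column j or column j + 1 leaves the same columns except in one place, which holds
    -- column j + 1 or column j respectively; these are equal by hypothesis.
    minors : ∀ i l → minor A (suc j) i l ≈ minor A (inject₁ j) i l
    minors i l with punchIn-adjacent j l
    ... | inj₁ e        = reflexive (≡.cong (A (suc i)) (≡.sym e))
    ... | inj₂ (e , e′) = begin
      A (suc i) (punchIn (suc j) l)      ≡⟨ ≡.cong (A (suc i)) e′ ⟩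
      A (suc i) (inject₁ j)              ≈⟨ eq (suc i) ⟩
      A (suc i) (suc j)                  ≡⟨ ≡.cong (A (suc i)) e ⟨
      A (suc i) (punchIn (inject₁ j) l)  ∎
    cancel : (- 1#) ^ toℕ (inject₁ j) * (A zero (inject₁ j) * det (minor A (inject₁ j))) +
             (- 1# * (- 1#) ^ toℕ j) * (A zero (suc j) * det (minor A (suc j))) ≈ 0#
    cancel = begin
      _ ≈⟨ +-cong (*-congʳ (reflexive (≡.cong ((- 1#) ^_) (Fin.toℕ-inject₁ j))))
                  (*-congˡ (*-cong (sym (eq zero)) (det-cong minors))) ⟩
      (- 1#) ^ toℕ j * (A zero (inject₁ j) * det (minor A (inject₁ j))) +
      (- 1# * (- 1#) ^ toℕ j) * (A zero (inject₁ j) * det (minor A (inject₁ j)))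
        ≈⟨ opposite _ _ ⟩
      0# ∎
    others : ∀ k → k ≢ inject₁ j → k ≢ suc j → (- 1#) ^ toℕ k * (A zero k * det (minor A k)) ≈ 0#
    others k k≢j k≢1+j with punchIn-avoids-adjacent k j k≢j k≢1+j
    ... | l , e , e′ = begin
      (- 1#) ^ toℕ k * (A zero k * det (minor A k))
        ≈⟨ *-congˡ (*-congˡ (det-adjacent-equal l (minor A k) λ i →
             ≡.subst₂ (λ p q → A (suc i) p ≈ A (suc i) q) (≡.sym e) (≡.sym e′) (eq (suc i)))) ⟩
      (- 1#) ^ toℕ k * (A zero k * 0#)  ≈⟨ *-congˡ (zeroʳ _) ⟩
      (- 1#) ^ toℕ k * 0#               ≈⟨ zeroʳ _ ⟩
      0#                                ∎

  private
    module TwoColumns {n} (A : Matrix n) {p q : Fin n} (p≢q : p ≢ q) where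

      replace : (u v : Vector Carrier n) → Matrix n
      replace u v i k with k Fin.≟ q | k Fin.≟ p
      ... | yes _ | _     = v i
      ... | no  _ | yes _ = u i
      ... | no  _ | no  _ = A i k

      replace-p : ∀ u v i → replace u v i p ≈ u i
      replace-p u v i with p Fin.≟ q | p Fin.≟ p
      ... | yes p≡q | _       = contradiction p≡q p≢q
      ... | no  _   | yes _   = refl
      ... | no  _   | no  p≢p = contradiction ≡.refl p≢p

      replace-q : ∀ u v i → replace u v i q ≈ v i
      replace-q u v i with q Fin.≟ q
      ... | yes _   = refl
      ... | no  q≢q = contradiction ≡.refl q≢q

      replace-off-p : ∀ u u′ v i k → k ≢ p → replace u v i k ≈ replace u′ v i k
      replace-off-p u u′ v i k k≢p with k Fin.≟ q | k Fin.≟ p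
      ... | yes _ | _       = refl
      ... | no  _ | yes k≡p = contradiction k≡p k≢p
      ... | no  _ | no  _   = refl

      replace-off-q : ∀ u v v′ i k → k ≢ q → replace u v i k ≈ replace u v′ i k
      replace-off-q u v v′ i k k≢q with k Fin.≟ q | k Fin.≟ p
      ... | yes k≡q | _     = contradiction k≡q k≢q
      ... | no  _   | yes _ = refl
      ... | no  _   | no  _ = refl

      replace-same : ∀ i k → replace (λ i → A i p) (λ i → A i q) i k ≈ A i k
      replace-same i k with k Fin.≟ q | k Fin.≟ p
      ... | yes ≡.refl | _          = refl
      ... | no  _      | yes ≡.refl = refl
      ... | no  _      | no  _      = refl

      infixl 6 _⊕_

      -- The coefficient `1#` gives the sum the shape that `det-linear` expects.
      _⊕_ : (u v : Vector Carrier n) → Vector Carrier n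
      (u ⊕ v) i = u i + 1# * v i

      det-replace-⊕ˡ : ∀ u v w → det (replace (u ⊕ v) w) ≈ det (replace u w) + 1# * det (replace v w)
      det-replace-⊕ˡ u v w = det-linear p 1#
        (λ i k → replace-off-p u (u ⊕ v) w i k) (λ i k → replace-off-p v (u ⊕ v) w i k)
        (λ i → trans (replace-p (u ⊕ v) w i)
          (sym (+-cong (replace-p u w i) (*-congˡ (replace-p v w i)))))

      det-replace-⊕ʳ : ∀ u v w → det (replace u (v ⊕ w)) ≈ det (replace u v) + 1# * det (replace u w)
      det-replace-⊕ʳ u v w = det-linear q 1#
        (λ i k → replace-off-q u v (v ⊕ w) i k) (λ i k → replace-off-q u w (v ⊕ w) i k)
        (λ i → trans (replace-q u (v ⊕ w) i)
          (sym (+-cong (replace-q u v i) (*-congˡ (replace-q u w i)))))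

      -- Polarisation of the vanishing on equal columns p and q.
      det-replace-swap : (∀ u → det (replace u u) ≈ 0#) → ∀ u v → det (replace v u) ≈ 0# → det (replace u v) ≈ 0#
      det-replace-swap alternating u v vu≈0 = sym (begin
        0#                                                                  ≈⟨ alternating (u ⊕ v) ⟨
        det (replace (u ⊕ v) (u ⊕ v))                                       ≈⟨ det-replace-⊕ˡ u v (u ⊕ v) ⟩
        det (replace u (u ⊕ v)) + 1# * det (replace v (u ⊕ v))
          ≈⟨ +-cong (det-replace-⊕ʳ u u v) (*-congˡ (det-replace-⊕ʳ v u v)) ⟩
        (det (replace u u) + 1# * d) + 1# * (det (replace v u) + 1# * det (replace v v))
          ≈⟨ +-cong (+-congʳ (alternating u)) (*-congˡ (+-cong vu≈0 (*-congˡ (alternating v)))) ⟩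
        (0# + 1# * d) + 1# * (0# + 1# * 0#)
          ≈⟨ solve 1 (λ d → (con 0 :+ con 1 :* d) :+ con 1 :* (con 0 :+ con 1 :* con 0) := d) refl d ⟩
        d                                                                   ∎)
        where d = det (replace u v)

  -- Induction on the distance between the two columns. Exchanging the second one with its left
  -- neighbour brings it one place closer, where the induction hypothesis applies;
  -- `det-replace-swap` carries the vanishing back across the exchange.
  det-equal-columns : ∀ {n} (j : Fin n) (A : Matrix (suc n)) → (∀ i → A i zero ≈ A i (suc j)) → det A ≈ 0#
  det-equal-columns {suc n} = <-weakInduction
    (λ j → (A : Matrix (suc (suc n))) → (∀ i → A i zero ≈ A i (suc j)) → det A ≈ 0#)
    (det-adjacent-equal zero) step
    where
    step : ∀ j → ((A : Matrix (suc (suc n))) → (∀ i → A i zero ≈ A i (suc (inject₁ j))) → det A ≈ 0#) →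
           (A : Matrix (suc (suc n))) → (∀ i → A i zero ≈ A i (suc (suc j))) → det A ≈ 0#
    step j ih A eq = trans (det-cong λ i k → sym (replace-same i k))
      (det-replace-swap
        (λ u → det-adjacent-equal (suc j) (replace u u) λ i → trans (replace-p u u i) (sym (replace-q u u i)))
        a b
        (ih (replace b a) λ i → trans (eq i) (sym (replace-p b a i))))
      where
      open TwoColumns A {suc (inject₁ j)} {suc (suc j)} (inject₁≢suc (suc j))
      a b : Vector Carrier (suc (suc n))
      a i = A i (suc (inject₁ j))
      b i = A i (suc (suc j))

  -- Column operations and pivoting

  addFirstColumn : ∀ {n} → Vector Carrier n → Matrix (suc n) → Matrix (suc n)
  addFirstColumn t A i zero    = A i zero
  addFirstColumn t A i (suc k) = A i (suc k) + t k * A i zero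

  -- The columns are changed one at a time, by cutting `t` off after its first ℓ entries. Each step
  -- adds a multiple of the determinant of `D`, in which column zero occurs twice.
  det-addFirstColumn : ∀ {n} (t : Vector Carrier n) (A : Matrix (suc n)) → det (addFirstColumn t A) ≈ det A
  det-addFirstColumn {n} t A = trans (det-cong full) (prefix n ℕ.≤-refl)
    where
    truncate : ℕ → Vector Carrier n
    truncate ℓ k with toℕ k ℕ.<? ℓ
    ... | yes _ = t k
    ... | no  _ = 0#

    full : ∀ i k → addFirstColumn t A i k ≈ addFirstColumn (truncate n) A i k
    full i zero = refl
    full i (suc k) with toℕ k ℕ.<? n
    ... | yes _   = refl
    ... | no  k≮n = contradiction (Fin.toℕ<n k) k≮n

    none : ∀ i k → addFirstColumn (truncate 0) A i k ≈ A i k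
    none i zero    = refl
    none i (suc k) = trans (+-congˡ (zeroˡ _)) (+-identityʳ _)

    prefix : ∀ ℓ → ℓ ℕ.≤ n → det (addFirstColumn (truncate ℓ) A) ≈ det A
    prefix zero    _   = det-cong none
    prefix (suc ℓ) ℓ<n = begin
      det (addFirstColumn (truncate (suc ℓ)) A)
        ≈⟨ det-linear (suc j) (t j) {addFirstColumn (truncate ℓ) A} {D} (λ i k k≢ → sym (off i k k≢)) D-off at ⟩
      det (addFirstColumn (truncate ℓ) A) + t j * det D
        ≈⟨ +-cong (prefix ℓ (ℕ.<⇒≤ ℓ<n)) (*-congˡ (det-equal-columns j D λ i → sym (D-at i))) ⟩
      det A + t j * 0#  ≈⟨ +-congˡ (zeroʳ (t j)) ⟩
      det A + 0#        ≈⟨ +-identityʳ (det A) ⟩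
      det A             ∎
      where
      j : Fin n
      j = Fin.fromℕ< ℓ<n

      j≡ℓ : toℕ j ≡ ℓ
      j≡ℓ = Fin.toℕ-fromℕ< ℓ<n

      D : Matrix (suc n)
      D i k with k Fin.≟ suc j
      ... | yes _ = A i zero
      ... | no  _ = addFirstColumn (truncate (suc ℓ)) A i k

      D-at : ∀ i → D i (suc j) ≈ A i zero
      D-at i with j Fin.≟ j
      ... | yes _   = refl
      ... | no  j≢j = contradiction ≡.refl j≢j

      D-off : ∀ i k → k ≢ suc j → D i k ≈ addFirstColumn (truncate (suc ℓ)) A i k
      D-off i k k≢j with k Fin.≟ suc j
      ... | yes k≡j = contradiction k≡j k≢j
      ... | no  _   = refl

      off : ∀ i k → k ≢ suc j →
            addFirstColumn (truncate (suc ℓ)) A i k ≈ addFirstColumn (truncate ℓ) A i k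
      off i zero    _   = refl
      off i (suc k) k≢j with toℕ k ℕ.<? suc ℓ | toℕ k ℕ.<? ℓ
      ... | yes _   | yes _   = refl
      ... | no  _   | no  _   = refl
      ... | no  k≮  | yes k<ℓ = contradiction (ℕ.m<n⇒m<1+n k<ℓ) k≮
      ... | yes k<  | no  k≮ℓ = contradiction
        (≡.cong suc (Fin.toℕ-injective (≡.trans (ℕ.≤-antisym (ℕ.≤-pred k<) (ℕ.≮⇒≥ k≮ℓ)) (≡.sym j≡ℓ)))) k≢j

      at : ∀ i → addFirstColumn (truncate (suc ℓ)) A i (suc j) ≈
                 addFirstColumn (truncate ℓ) A i (suc j) + t j * D i (suc j)
      at i with toℕ j ℕ.<? suc ℓ | toℕ j ℕ.<? ℓ
      ... | no j≮ | _       = contradiction (ℕ.≤-reflexive (≡.cong suc j≡ℓ)) j≮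
      ... | yes _ | yes j<ℓ = contradiction j<ℓ (ℕ.<-irrefl j≡ℓ)
      ... | yes _ | no  _   = +-cong
        (sym (trans (+-congˡ (zeroˡ _)) (+-identityʳ _))) (*-congˡ (sym (D-at i)))

  -- Linearity in the first row: that of `A` is p·e₀ plus t times that of `B`, and the part p·e₀
  -- contributes a single cofactor.
  det-expand : ∀ {n} (A B : Matrix (suc n)) p t → A zero zero ≈ p + t * B zero zero →
    (∀ j → A zero (suc j) ≈ t * B zero (suc j)) → (∀ i j → A (suc i) j ≈ B (suc i) j) →
    det A ≈ p * det (minor A zero) + t * det B
  det-expand A B p t head tail below = begin
    1# * (A zero zero * det (minor A zero)) + sum (λ j → s j * (A zero (suc j) * det (minor A (suc j))))
      ≈⟨ +-cong (*-congˡ (*-congʳ head)) (sum-linear t tails) ⟩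
    1# * ((p + t * B zero zero) * det (minor A zero)) + (sum (λ j → s j * 0#) + t * S)
      ≈⟨ +-cong split (+-congʳ (sum≈0 λ j → zeroʳ (s j))) ⟩
    (p * det (minor A zero) + t * (1# * (B zero zero * det (minor A zero)))) + (0# + t * S)
      ≈⟨ +-congʳ (+-congˡ (*-congˡ (*-congˡ (*-congˡ (det-cong λ i k → below i (suc k)))))) ⟩
    (p * det (minor A zero) + t * T) + (0# + t * S)
      ≈⟨ solve 4 (λ a t b c → (a :+ t :* b) :+ (con 0 :+ t :* c) := a :+ t :* (b :+ c)) refl _ t T S ⟩
    p * det (minor A zero) + t * (T + S) ∎
    where
    s : Fin _ → Carrier
    s j = (- 1#) ^ toℕ (suc j)
    S T : Carrier
    S = sum λ j → s j * (B zero (suc j) * det (minor B (suc j)))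
    T = 1# * (B zero zero * det (minor B zero))
    split : 1# * ((p + t * B zero zero) * det (minor A zero)) ≈
            p * det (minor A zero) + t * (1# * (B zero zero * det (minor A zero)))
    split = solve 4 (λ p t b d → con 1 :* ((p :+ t :* b) :* d) := p :* d :+ t :* (con 1 :* (b :* d)))
              refl p t (B zero zero) (det (minor A zero))
    tails : ∀ j → s j * (A zero (suc j) * det (minor A (suc j))) ≈
                  s j * 0# + t * (s j * (B zero (suc j) * det (minor B (suc j))))
    tails j = begin
      s j * (A zero (suc j) * det (minor A (suc j)))
        ≈⟨ *-congˡ (*-cong (tail j) (det-cong λ i k → below i (punchIn (suc j) k))) ⟩
      s j * ((t * B zero (suc j)) * det (minor B (suc j)))
        ≈⟨ solve 4 (λ s t b d → s :* ((t :* b) :* d) := s :* con 0 :+ t :* (s :* (b :* d)))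
             refl (s j) t (B zero (suc j)) (det (minor B (suc j))) ⟩
      s j * 0# + t * (s j * (B zero (suc j) * det (minor B (suc j)))) ∎

  det-firstRow : ∀ {n} (A : Matrix (suc n)) → (∀ j → A zero (suc j) ≈ 0#) →
    det A ≈ A zero zero * det (minor A zero)
  det-firstRow A tail = begin
    det A ≈⟨ det-expand A A (A zero zero) 0# (sym (trans (+-congˡ (zeroˡ _)) (+-identityʳ _)))
               (λ j → trans (tail j) (sym (zeroˡ _))) (λ _ _ → refl) ⟩
    A zero zero * det (minor A zero) + 0# * det A ≈⟨ +-congˡ (zeroˡ (det A)) ⟩
    A zero zero * det (minor A zero) + 0#         ≈⟨ +-identityʳ _ ⟩
    A zero zero * det (minor A zero)              ∎

  -- Subtracting multiples of column zero clears the rest of the first row. What remains is the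
  -- Schur complement of the pivot, which needs no division because the pivot is 1.
  det-pivot : ∀ {n} (A : Matrix (suc n)) → A zero zero ≈ 1# →
    det A ≈ det (λ i j → A (suc i) (suc j) + - A zero (suc j) * A (suc i) zero)
  det-pivot A A₀₀≈1 = begin
    det A                                             ≈⟨ det-addFirstColumn t A ⟨
    det (addFirstColumn t A)                          ≈⟨ det-firstRow (addFirstColumn t A) clear ⟩
    A zero zero * det (minor (addFirstColumn t A) zero) ≈⟨ *-congʳ A₀₀≈1 ⟩
    1# * det (minor (addFirstColumn t A) zero)        ≈⟨ *-identityˡ _ ⟩
    det (minor (addFirstColumn t A) zero)             ∎
    where
    t : Vector Carrier _
    t j = - A zero (suc j)
    clear : ∀ j → A zero (suc j) + t j * A zero zero ≈ 0#
    clear j = begin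
      A zero (suc j) + t j * A zero zero ≈⟨ +-congˡ (*-congˡ A₀₀≈1) ⟩
      A zero (suc j) + t j * 1#          ≈⟨ +-congˡ (*-identityʳ (t j)) ⟩
      A zero (suc j) + t j               ≈⟨ -‿inverseʳ (A zero (suc j)) ⟩
      0#                                 ∎

  -- Determinants of xI + zJ and of the two-block matrix

  scalar : ∀ {n} → Carrier → Matrix n
  scalar x i j with i Fin.≟ j
  ... | yes _ = x
  ... | no  _ = 0#

  scalar-suc : ∀ {n} x (i j : Fin n) → scalar x (suc i) (suc j) ≈ scalar x i j
  scalar-suc x i j with i Fin.≟ j
  ... | yes _ = refl
  ... | no  _ = refl

  det-scalar : ∀ n x → det (scalar {n} x) ≈ x ^ n
  det-scalar zero    x = refl
  det-scalar (suc n) x = trans (det-firstRow (scalar {suc n} x) λ _ → refl)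
    (*-congˡ (trans (det-cong {n} (scalar-suc x)) (det-scalar n x)))

  -- The first row of xI + zJ is x·e₀ + z(1, ..., 1). Pivoting on the leading 1 of the second
  -- summand subtracts z from every remaining entry and leaves xI, so the determinants satisfy D(n +
  -- 1) = x·D(n) + z·xⁿ.
  det-scalar+const : ∀ n x z → det {suc n} (λ i j → scalar x i j + z) ≈ x ^ n * (x + (suc n · 1#) * z)
  det-scalar+const n x z = begin
    det A                          ≈⟨ det-expand A B x z (+-congˡ (sym (*-identityʳ z)))
                                        (λ j → trans (+-identityˡ z) (sym (*-identityʳ z))) (λ _ _ → refl) ⟩
    x * det (minor A zero) + z * det B
      ≈⟨ +-cong (*-congˡ (det-cong {n} λ i j → +-congʳ {z} (scalar-suc x i j))) (*-congˡ det-B) ⟩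
    x * det (λ (i j : Fin n) → scalar x i j + z) + z * x ^ n ≈⟨ recurse n ⟩
    x ^ n * (x + (suc n · 1#) * z)        ∎
    where
    A B : Matrix (suc n)
    A i j = scalar x i j + z
    B zero    j = 1#
    B (suc i) j = A (suc i) j

    det-B : det B ≈ x ^ n
    det-B = begin
      det B ≈⟨ det-pivot B refl ⟩
      det (λ (i j : Fin n) → (scalar x (suc i) (suc j) + z) + - 1# * (0# + z)) ≈⟨ det-cong {n} (λ i j → begin
        (scalar x (suc i) (suc j) + z) + - 1# * (0# + z)  ≈⟨ +-cong (+-congʳ (scalar-suc x i j)) (trans (-1*x≈-x _) (-‿cong (+-identityˡ z))) ⟩
        (scalar x i j + z) - z                            ≈⟨ +-assoc _ z (- z) ⟩
        scalar x i j + (z - z)                            ≈⟨ +-congˡ (-‿inverseʳ z) ⟩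
        scalar x i j + 0#                                 ≈⟨ +-identityʳ _ ⟩
        scalar x i j                                      ∎) ⟩
      det (scalar {n} x) ≈⟨ det-scalar n x ⟩
      x ^ n ∎

    -- The case split separates the empty matrix, of determinant 1, from the positive sizes to which
    -- the closed form applies.
    recurse : ∀ n → x * det (λ (i j : Fin n) → scalar x i j + z) + z * x ^ n ≈ x ^ n * (x + (suc n · 1#) * z)
    recurse zero = solve 2 (λ x z → x :* con 1 :+ z :* con 1 := con 1 :* (x :+ (con 1 :+ con 0) :* z)) refl x z
    recurse (suc n) = begin
      x * det (λ (i j : Fin (suc n)) → scalar x i j + z) + z * x ^ suc n
        ≈⟨ +-congʳ (*-congˡ (det-scalar+const n x z)) ⟩
      x * (x ^ n * (x + (suc n · 1#) * z)) + z * (x * x ^ n)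
        ≈⟨ solve 4 (λ x z P N → x :* (P :* (x :+ N :* z)) :+ z :* (x :* P) := (x :* P) :* (x :+ (con 1 :+ N) :* z))
             refl x z (x ^ n) (suc n · 1#) ⟩
      x ^ suc n * (x + (suc (suc n) · 1#) * z) ∎

  link : ∀ {m n} → Carrier → Carrier → Fin m ⊎ Fin n → Fin m ⊎ Fin n → Carrier
  link y z (inj₁ _) (inj₁ _) = 0#
  link y z (inj₁ _) (inj₂ _) = y
  link y z (inj₂ _) (inj₁ _) = y
  link y z (inj₂ _) (inj₂ _) = z

  bipartite : ∀ m n → (x y z : Carrier) → Matrix (m ℕ.+ n)
  bipartite m n x y z i j = scalar x i j + link y z (splitAt m i) (splitAt m j)

  -- u plays the role of − y, which keeps the computations below semiring identities.
  det-bipartite-suc : ∀ m n x y z u → y + u ≈ 0# →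
    det (bipartite (suc m) n x y z) ≈
    (x + u) * det (bipartite m n x y z) + y * det (bipartite m n x y (z + u))
  det-bipartite-suc m n x y z u y+u≈0 = begin
    det A
      ≈⟨ det-expand A B (x + u) y head tail (λ _ _ → refl) ⟩
    (x + u) * det (minor A zero) + y * det B
      ≈⟨ +-cong (*-congˡ (det-cong (λ i j → +-cong (scalar-suc x i j) (link-suc (splitAt m i) (splitAt m j)))))
           (*-congˡ (trans (det-pivot B refl) (det-cong λ i j → begin
             A (suc i) (suc j) + - join (Sum.map suc id (splitAt m j)) * A (suc i) zero
               ≈⟨ +-congʳ (+-congʳ (scalar-suc x i j)) ⟩
             (scalar x i j + link y z (Sum.map suc id (splitAt m i)) (Sum.map suc id (splitAt m j))) +
             - join (Sum.map suc id (splitAt m j)) * (0# + link y z (Sum.map suc id (splitAt m i)) (inj₁ zero))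
               ≈⟨ schur (scalar x i j) (splitAt m i) (splitAt m j) ⟩
             bipartite m n x y (z + u) i j ∎))) ⟩
    (x + u) * det (bipartite m n x y z) + y * det (bipartite m n x y (z + u)) ∎
    where
    join : Fin (suc m) ⊎ Fin n → Carrier
    join (inj₁ _) = 0#
    join (inj₂ _) = 1#

    A B : Matrix (suc (m ℕ.+ n))
    A = bipartite (suc m) n x y z
    B zero    zero    = 1#
    B zero    (suc j) = join (Sum.map suc id (splitAt m j))
    B (suc i) j       = A (suc i) j

    head : x + 0# ≈ (x + u) + y * 1#
    head = begin
      x + 0#            ≈⟨ +-congˡ y+u≈0 ⟨
      x + (y + u)       ≈⟨ solve 3 (λ x y u → x :+ (y :+ u) := (x :+ u) :+ y :* con 1) refl x y u ⟩
      (x + u) + y * 1#  ∎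

    tail : ∀ j → A zero (suc j) ≈ y * B zero (suc j)
    tail j with splitAt m j
    ... | inj₁ _ = trans (+-identityˡ 0#) (sym (zeroʳ y))
    ... | inj₂ _ = trans (+-identityˡ y) (sym (*-identityʳ y))

    link-suc : ∀ s t → link y z (Sum.map suc id s) (Sum.map suc id t) ≈ link {m} {n} y z s t
    link-suc (inj₁ _) (inj₁ _) = refl
    link-suc (inj₁ _) (inj₂ _) = refl
    link-suc (inj₂ _) (inj₁ _) = refl
    link-suc (inj₂ _) (inj₂ _) = refl

    -y≈u : - 1# * (0# + y) ≈ u
    -y≈u = begin
      - 1# * (0# + y)  ≈⟨ -1*x≈-x _ ⟩
      - (0# + y)       ≈⟨ -‿cong (+-identityˡ y) ⟩
      - y              ≈⟨ +-inverseʳ-unique y u y+u≈0 ⟨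
      u                ∎

    unchanged : ∀ a b {c d} → c * d ≈ 0# → (a + b) + c * d ≈ a + b
    unchanged a b cd≈0 = trans (+-congˡ cd≈0) (+-identityʳ (a + b))

    -0*x≈0 : ∀ v → - 0# * v ≈ 0#
    -0*x≈0 v = trans (*-congʳ -0#≈0#) (zeroˡ v)

    schur : ∀ a s t →
      (a + link y z (Sum.map suc id s) (Sum.map suc id t)) +
      - join (Sum.map suc id t) * (0# + link {suc m} {n} y z (Sum.map suc id s) (inj₁ zero)) ≈
      a + link {m} {n} y (z + u) s t
    schur a (inj₁ _) (inj₁ _) = unchanged a 0# (-0*x≈0 _)
    schur a (inj₂ _) (inj₁ _) = unchanged a y (-0*x≈0 _)
    schur a (inj₁ _) (inj₂ _) = unchanged a y (trans (*-congˡ (+-identityˡ 0#)) (zeroʳ (- 1#)))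
    schur a (inj₂ _) (inj₂ _) = trans (+-congˡ -y≈u) (+-assoc a z u)

  -- Vectors supported on one part with coordinate sum zero account for the power of `x`. The
  -- quadratic factor is the determinant of the quotient matrix [[x, N·y], [M·y, x + N·z]] for parts
  -- of sizes M and N, with -y² written as y·u.
  det-bipartite : ∀ m n x y z u → y + u ≈ 0# →
    det (bipartite (suc m) (suc n) x y z) ≈
    x ^ (m ℕ.+ n) * (x * x + (suc n · 1#) * z * x + (suc m · 1#) * (suc n · 1#) * (y * u))
  det-bipartite zero n x y z u y+u≈0 = begin
    det (bipartite 1 (suc n) x y z)
      ≈⟨ det-bipartite-suc 0 (suc n) x y z u y+u≈0 ⟩
    (x + u) * det (bipartite 0 (suc n) x y z) + y * det (bipartite 0 (suc n) x y (z + u))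
      ≈⟨ +-cong (*-congˡ (det-scalar+const n x z)) (*-congˡ (det-scalar+const n x (z + u))) ⟩
    (x + u) * (P * (x + N * z)) + y * (P * (x + N * (z + u)))
      -- The closed form holds only modulo y + u = 0, so the semiring identity carries the
      -- discrepancy as an explicit multiple of y + u, which then vanishes.
      ≈⟨ solve 6 (λ x y z u P N →
           (x :+ u) :* (P :* (x :+ N :* z)) :+ y :* (P :* (x :+ N :* (z :+ u))) :=
           P :* (x :* x :+ N :* z :* x :+ (con 1 :+ con 0) :* N :* (y :* u)) :+ (y :+ u) :* (P :* (x :+ N :* z)))
           refl x y z u P N ⟩
    P * (x * x + N * z * x + (1 · 1#) * N * (y * u)) + (y + u) * (P * (x + N * z))
      ≈⟨ +-congˡ (trans (*-congʳ y+u≈0) (zeroˡ _)) ⟩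
    P * (x * x + N * z * x + (1 · 1#) * N * (y * u)) + 0#
      ≈⟨ +-identityʳ _ ⟩
    P * (x * x + N * z * x + (1 · 1#) * N * (y * u)) ∎
    where
    P N : Carrier
    P = x ^ n
    N = suc n · 1#
  det-bipartite (suc m) n x y z u y+u≈0 = begin
    det (bipartite (suc (suc m)) (suc n) x y z)
      ≈⟨ det-bipartite-suc (suc m) (suc n) x y z u y+u≈0 ⟩
    (x + u) * det (bipartite (suc m) (suc n) x y z) + y * det (bipartite (suc m) (suc n) x y (z + u))
      ≈⟨ +-cong (*-congˡ (det-bipartite m n x y z u y+u≈0)) (*-congˡ (det-bipartite m n x y (z + u) u y+u≈0)) ⟩
    (x + u) * (P * Q) + y * (P * (x * x + N * (z + u) * x + M * N * (y * u)))
      ≈⟨ solve 7 (λ x y z u P M N →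
           (x :+ u) :* (P :* (x :* x :+ N :* z :* x :+ M :* N :* (y :* u))) :+
           y :* (P :* (x :* x :+ N :* (z :+ u) :* x :+ M :* N :* (y :* u))) :=
           (x :* P) :* (x :* x :+ N :* z :* x :+ (con 1 :+ M) :* N :* (y :* u)) :+
           (y :+ u) :* (P :* (x :* x :+ N :* z :* x :+ M :* N :* (y :* u))))
           refl x y z u P M N ⟩
    (x * P) * (x * x + N * z * x + (suc (suc m) · 1#) * N * (y * u)) + (y + u) * (P * Q)
      ≈⟨ +-congˡ (trans (*-congʳ y+u≈0) (zeroˡ _)) ⟩
    (x * P) * (x * x + N * z * x + (suc (suc m) · 1#) * N * (y * u)) + 0#
      ≈⟨ +-identityʳ _ ⟩
    (x * P) * (x * x + N * z * x + (suc (suc m) · 1#) * N * (y * u)) ∎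
    where
    P M N Q : Carrier
    P = x ^ (m ℕ.+ n)
    M = suc m · 1#
    N = suc n · 1#
    Q = x * x + N * z * x + M * N * (y * u)

-- Cancellation, powers and products in a commutative ring

module RingLemmas {c ℓ} (R : CommutativeRing c ℓ) where

  open CommutativeRing R hiding (zero)
  open import Algebra.Definitions.RawSemiring (Semiring.rawSemiring semiring) using (_^_; product)
  open import Algebra.Properties.Monoid.Mult +-monoid using () renaming (_×_ to _·_)
  open import Algebra.Properties.Ring ring using (-‿distribˡ-*; -‿distribʳ-*)
  open import Algebra.Properties.Semiring.Mult semiring using (×1-homo-*)
  open import Algebra.Properties.CommutativeSemigroup *-commutativeSemigroup using (interchange)
  open import Relation.Binary.Reasoning.Setoid setoid

  inverse-square : ∀ {s k t} → s * s ≈ k → s * t ≈ 1# → k * (t * t) ≈ 1#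
  inverse-square {s} {k} {t} ss≈k st≈1 = begin
    k * (t * t)        ≈⟨ *-congʳ ss≈k ⟨
    (s * s) * (t * t)  ≈⟨ interchange s s t t ⟩
    (s * t) * (s * t)  ≈⟨ *-cong st≈1 st≈1 ⟩
    1# * 1#            ≈⟨ *-identityˡ 1# ⟩
    1#                 ∎

  unit-cancel : ∀ {a b y} → a * b ≈ 1# → a * y ≈ 0# → y ≈ 0#
  unit-cancel {a} {b} {y} ab≈1 ay≈0 = begin
    y            ≈⟨ *-identityˡ y ⟨
    1# * y       ≈⟨ *-congʳ (trans (*-comm b a) ab≈1) ⟨
    (b * a) * y  ≈⟨ *-assoc b a y ⟩
    b * (a * y)  ≈⟨ *-congˡ ay≈0 ⟩
    b * 0#       ≈⟨ zeroʳ b ⟩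
    0#           ∎

  unit-^-cancel : ∀ {a b y} → a * b ≈ 1# → ∀ k → a ^ k * y ≈ 0# → y ≈ 0#
  unit-^-cancel ab≈1 zero    eq = trans (sym (*-identityˡ _)) eq
  unit-^-cancel ab≈1 (suc k) eq = unit-^-cancel ab≈1 k (unit-cancel ab≈1 (trans (sym (*-assoc _ _ _)) eq))

  product≈0 : ∀ {n} (f : Vector Carrier n) i → f i ≈ 0# → product f ≈ 0#
  product≈0 f zero    eq = trans (*-congʳ eq) (zeroˡ _)
  product≈0 f (suc i) eq = trans (*-congˡ (product≈0 (f ∘ suc) i eq)) (zeroʳ _)

  ·-^ : ∀ a k → (a · 1#) ^ k ≈ (a ℕ.^ k) · 1#
  ·-^ a zero    = sym (+-identityʳ 1#)
  ·-^ a (suc k) = trans (*-congˡ (·-^ a k)) (sym (×1-homo-* a (a ℕ.^ k)))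

  -- The right-hand side of `det-bipartite` at z = 0, y = -c and u = c, where c is the Randić weight
  -- of an edge.
  bipartite-factor : ∀ P x M N c → M * N * (c * c) ≈ 1# →
    P * (x * x + N * 0# * x + M * N * (- c * c)) ≈ P * (x ^ 2 - 1#)
  bipartite-factor P x M N c eq = *-congˡ (+-cong
    (trans (+-cong (*-congˡ (sym (*-identityʳ x))) (trans (*-congʳ (zeroʳ N)) (zeroˡ x))) (+-identityʳ _))
    (begin
      M * N * (- c * c)    ≈⟨ *-congˡ (-‿distribˡ-* c c) ⟨
      M * N * - (c * c)    ≈⟨ -‿distribʳ-* (M * N) (c * c) ⟨
      - (M * N * (c * c))  ≈⟨ -‿cong eq ⟩
      - 1#                 ∎))

open import Defs

-- The commutative ring of Cauchy reals

private
  ∣p-p∣≡0 : ∀ p → ℚ.∣ p ℚ.- p ∣ ≡ 0ℚ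
  ∣p-p∣≡0 p = ≡.cong ℚ.∣_∣ (ℚ.+-inverseʳ p)

  -‿anticomm : ∀ p q → ℚ.- (p ℚ.- q) ≡ q ℚ.- p
  -‿anticomm = solve-∀ ℚ-ring

  -‿telescope : ∀ p q r → (p ℚ.- q) ℚ.+ (q ℚ.- r) ≡ p ℚ.- r
  -‿telescope = solve-∀ ℚ-ring

  +-interchange : ∀ p q r s → (p ℚ.- q) ℚ.+ (r ℚ.- s) ≡ (p ℚ.+ r) ℚ.- (q ℚ.+ s)
  +-interchange = solve-∀ ℚ-ring

  -‿telescope′ : ∀ p q → (p ℚ.- q) ℚ.+ q ≡ p
  -‿telescope′ = solve-∀ ℚ-ring

  neg-distrib : ∀ p q → ℚ.- (p ℚ.- q) ≡ (ℚ.- p) ℚ.- (ℚ.- q)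
  neg-distrib = solve-∀ ℚ-ring

  p+q-p≡q : ∀ p q → (p ℚ.+ q) ℚ.- p ≡ q
  p+q-p≡q = solve-∀ ℚ-ring

  p-0≡p : ∀ p → p ℚ.- 0ℚ ≡ p
  p-0≡p = solve-∀ ℚ-ring

∣p-q∣≡∣q-p∣ : ∀ p q → ℚ.∣ p ℚ.- q ∣ ≡ ℚ.∣ q ℚ.- p ∣
∣p-q∣≡∣q-p∣ p q = ≡.trans (≡.sym (ℚ.∣-p∣≡∣p∣ (p ℚ.- q))) (≡.cong ℚ.∣_∣ (-‿anticomm p q))

p≤q⇒0≤q-p : ∀ {p q} → p ℚ.≤ q → 0ℚ ℚ.≤ q ℚ.- p
p≤q⇒0≤q-p {p} {q} p≤q = ≡.subst (ℚ._≤ q ℚ.- p) (ℚ.+-inverseʳ p) (ℚ.+-monoˡ-≤ (ℚ.- p) p≤q)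

pointwise : ∀ x y → (∀ i → seq x i ≡ seq y i) → x ≈ y
pointwise x y eq ε 0<ε = 0 , λ i _ →
  ≡.subst (ℚ._< ε) (≡.sym (≡.trans (≡.cong (λ p → ℚ.∣ p ℚ.- seq y i ∣) (eq i)) (∣p-p∣≡0 (seq y i)))) 0<ε

≈-refl : ∀ {x} → x ≈ x
≈-refl {x} = pointwise x x λ _ → ≡.refl

≈-sym : ∀ {x y} → x ≈ y → y ≈ x
≈-sym {x} {y} x≈y ε 0<ε with x≈y ε 0<ε
... | N , close = N , λ i N≤i → ≡.subst (ℚ._< ε) (∣p-q∣≡∣q-p∣ (seq x i) (seq y i)) (close i N≤i)

≈-trans : ∀ {x y z} → x ≈ y → y ≈ z → x ≈ z
≈-trans {x} {y} {z} x≈y y≈z ε 0<ε with x≈y (½ ℚ.* ε) (half-pos 0<ε) | y≈z (½ ℚ.* ε) (half-pos 0<ε)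
... | M , closeˣ | N , closeʸ = M ⊔ N , λ i i≥ →
  ≡.subst₂ (λ p q → ℚ.∣ p ∣ ℚ.< q) (-‿telescope (seq x i) (seq y i) (seq z i)) (half+half ε)
    (triangle {seq x i ℚ.- seq y i} (closeˣ i (ℕ.m⊔n≤o⇒m≤o M N i≥)) (closeʸ i (ℕ.m⊔n≤o⇒n≤o M N i≥)))

+-cong : ∀ {x x′ y y′} → x ≈ x′ → y ≈ y′ → x + y ≈ x′ + y′
+-cong {x} {x′} {y} {y′} x≈x′ y≈y′ ε 0<ε
  with x≈x′ (½ ℚ.* ε) (half-pos 0<ε) | y≈y′ (½ ℚ.* ε) (half-pos 0<ε)
... | M , closeˣ | N , closeʸ = M ⊔ N , λ i i≥ →
  ≡.subst₂ (λ p q → ℚ.∣ p ∣ ℚ.< q) (+-interchange (seq x i) (seq x′ i) (seq y i) (seq y′ i)) (half+half ε)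
    (triangle {seq x i ℚ.- seq x′ i} (closeˣ i (ℕ.m⊔n≤o⇒m≤o M N i≥)) (closeʸ i (ℕ.m⊔n≤o⇒n≤o M N i≥)))

-‿cong : ∀ {x y} → x ≈ y → - x ≈ - y
-‿cong {x} {y} x≈y ε 0<ε with x≈y ε 0<ε
... | N , close = N , λ i N≤i → ≡.subst (ℚ._< ε)
  (≡.trans (≡.sym (ℚ.∣-p∣≡∣p∣ (seq x i ℚ.- seq y i))) (≡.cong ℚ.∣_∣ (neg-distrib (seq x i) (seq y i))))
  (close i N≤i)

*-cong : ∀ {x x′ y y′} → x ≈ x′ → y ≈ y′ → x * y ≈ x′ * y′
*-cong {x} {x′} {y} {y′} x≈x′ y≈y′ ε 0<ε =
  let A , 0<A , I , boundˣ = eventuallyBounded x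
      B , 0<B , J , boundʸ = eventuallyBounded y′
      C , 0<C , A<C , B<C  = commonBound 0<A 0<B
      δ , 0<δ , Cδ≡½ε      = shrink 0<C (half-pos 0<ε)
      M , closeˣ           = x≈x′ δ 0<δ
      N , closeʸ           = y≈y′ δ 0<δ
  in (I ⊔ J) ⊔ (M ⊔ N) , λ i i≥ →
    let i≥₁ = ℕ.m⊔n≤o⇒m≤o (I ⊔ J) (M ⊔ N) i≥
        i≥₂ = ℕ.m⊔n≤o⇒n≤o (I ⊔ J) (M ⊔ N) i≥
    in *-close {seq x i} {seq x′ i} {seq y i} {seq y′ i} 0<C Cδ≡½ε
         (ℚ.<-trans (boundˣ i (ℕ.m⊔n≤o⇒m≤o I J i≥₁)) A<C)
         (ℚ.<-trans (boundʸ i (ℕ.m⊔n≤o⇒n≤o I J i≥₁)) B<C)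
         (closeˣ i (ℕ.m⊔n≤o⇒m≤o M N i≥₂))
         (closeʸ i (ℕ.m⊔n≤o⇒n≤o M N i≥₂))

∣∣-cong : ∀ {x y} → x ≈ y → ∣ x ∣ ≈ ∣ y ∣
∣∣-cong {x} {y} x≈y ε 0<ε with x≈y ε 0<ε
... | N , close = N , λ i N≤i →
  ∣p∣<ε (below (seq x i) (seq y i) (close i N≤i))
    (≡.subst (ℚ._< ε) (≡.sym (-‿anticomm ℚ.∣ seq x i ∣ ℚ.∣ seq y i ∣))
      (below (seq y i) (seq x i) (≡.subst (ℚ._< ε) (∣p-q∣≡∣q-p∣ (seq x i) (seq y i)) (close i N≤i))))
  where
  below : ∀ p q → ℚ.∣ p ℚ.- q ∣ ℚ.< ε → ℚ.∣ p ∣ ℚ.- ℚ.∣ q ∣ ℚ.< ε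
  below p q lt = begin-strict
    ℚ.∣ p ∣ ℚ.- ℚ.∣ q ∣                          ≡⟨ ≡.cong (λ r → ℚ.∣ r ∣ ℚ.- ℚ.∣ q ∣) (-‿telescope′ p q) ⟨
    ℚ.∣ (p ℚ.- q) ℚ.+ q ∣ ℚ.- ℚ.∣ q ∣            ≤⟨ ℚ.+-monoˡ-≤ (ℚ.- ℚ.∣ q ∣) (ℚ.∣p+q∣≤∣p∣+∣q∣ (p ℚ.- q) q) ⟩
    (ℚ.∣ p ℚ.- q ∣ ℚ.+ ℚ.∣ q ∣) ℚ.- ℚ.∣ q ∣      ≡⟨ cancel ℚ.∣ p ℚ.- q ∣ ℚ.∣ q ∣ ⟩
    ℚ.∣ p ℚ.- q ∣                                <⟨ lt ⟩
    ε                                            ∎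
    where
    open ℚ.≤-Reasoning
    cancel : ∀ a b → (a ℚ.+ b) ℚ.- b ≡ a
    cancel a b = ≡.trans (ℚ.+-assoc a b (ℚ.- b)) (≡.trans (≡.cong (a ℚ.+_) (ℚ.+-inverseʳ b)) (ℚ.+-identityʳ a))

ℝ-commutativeRing : CommutativeRing 0ℓ 0ℓ
ℝ-commutativeRing = record
  { Carrier = ℝ ; _≈_ = _≈_ ; _+_ = _+_ ; _*_ = _*_ ; -_ = -_ ; 0# = 0ℝ ; 1# = 1ℝ
  ; isCommutativeRing = record
    { isRing = record
      { +-isAbelianGroup = record
        { isGroup = record
          { isMonoid = record
            { isSemigroup = record
              { isMagma = record
                { isEquivalence = record
                  { refl  = λ {x} → ≈-refl {x}
                  ; sym   = λ {x} {y} → ≈-sym {x} {y}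
                  ; trans = λ {x} {y} {z} → ≈-trans {x} {y} {z}
                  }
                ; ∙-cong = λ {x} {x′} {y} {y′} → +-cong {x} {x′} {y} {y′}
                }
              ; assoc = λ x y z → pointwise (x + y + z) (x + (y + z)) λ i → ℚ.+-assoc (seq x i) (seq y i) (seq z i)
              }
            ; identity = (λ x → pointwise (0ℝ + x) x λ i → ℚ.+-identityˡ (seq x i)) ,
                         (λ x → pointwise (x + 0ℝ) x λ i → ℚ.+-identityʳ (seq x i))
            }
          ; inverse = (λ x → pointwise (- x + x) 0ℝ λ i → ℚ.+-inverseˡ (seq x i)) ,
                      (λ x → pointwise (x - x) 0ℝ λ i → ℚ.+-inverseʳ (seq x i))
          ; ⁻¹-cong = λ {x} {y} → -‿cong {x} {y}
          }
        ; comm = λ x y → pointwise (x + y) (y + x) λ i → ℚ.+-comm (seq x i) (seq y i)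
        }
      ; *-cong = λ {x} {x′} {y} {y′} → *-cong {x} {x′} {y} {y′}
      ; *-assoc = λ x y z → pointwise (x * y * z) (x * (y * z)) λ i → ℚ.*-assoc (seq x i) (seq y i) (seq z i)
      ; *-identity = (λ x → pointwise (1ℝ * x) x λ i → ℚ.*-identityˡ (seq x i)) ,
                     (λ x → pointwise (x * 1ℝ) x λ i → ℚ.*-identityʳ (seq x i))
      ; distrib = (λ x y z → pointwise (x * (y + z)) (x * y + x * z) λ i → ℚ.*-distribˡ-+ (seq x i) (seq y i) (seq z i)) ,
                  (λ x y z → pointwise ((y + z) * x) (y * x + z * x) λ i → ℚ.*-distribʳ-+ (seq x i) (seq y i) (seq z i))
      }
    ; *-comm = λ x y → pointwise (x * y) (y * x) λ i → ℚ.*-comm (seq x i) (seq y i)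
    }
  }

-- Apartness and equality

#0⇒≉0 : ∀ {x} → x #0 → ¬ (x ≈ 0ℝ)
#0⇒≉0 {x} (c , 0<c , M , away) x≈0 with x≈0 c 0<c
... | N , close = ℚ.<-irrefl ≡.refl (ℚ.≤-<-trans
  (away (M ⊔ N) (ℕ.m≤m⊔n M N))
  (≡.subst (λ p → ℚ.∣ p ∣ ℚ.< c) (p-0≡p (seq x (M ⊔ N))) (close (M ⊔ N) (ℕ.m≤n⊔m M N))))

-- A single term `seq x N`, beyond which the sequence varies by less than ε/4, decides the matter by
-- a rational comparison. If it is below ε/2 in absolute value, the tail stays below ε; if not, the
-- tail stays at least ε/4 from zero, which is apartness.
¬#0⇒≈0 : ∀ {x} → ¬ (x #0) → x ≈ 0ℝ
¬#0⇒≈0 {x} ¬x#0 ε 0<ε with cauchy x (½ ℚ.* (½ ℚ.* ε)) (half-pos (half-pos 0<ε))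
... | N , close with ℚ.∣ seq x N ∣ ℚ.<? ½ ℚ.* ε
...   | yes small = N , λ i N≤i → begin-strict
        ℚ.∣ seq x i ℚ.- 0ℚ ∣                       ≡⟨ ≡.cong ℚ.∣_∣ (p-0≡p (seq x i)) ⟩
        ℚ.∣ seq x i ∣                              ≡⟨ ≡.cong ℚ.∣_∣ (-‿telescope′ (seq x i) (seq x N)) ⟨
        ℚ.∣ (seq x i ℚ.- seq x N) ℚ.+ seq x N ∣    <⟨ triangle {seq x i ℚ.- seq x N} (close i N N≤i ℕ.≤-refl) small ⟩
        ½ ℚ.* h ℚ.+ h                              ≤⟨ ℚ.+-monoˡ-≤ h h/2≤h ⟩
        h ℚ.+ h                                    ≡⟨ half+half ε ⟩
        ε                                          ∎
  where
  open ℚ.≤-Reasoning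
  h : ℚ
  h = ½ ℚ.* ε
  h/2≤h : ½ ℚ.* h ℚ.≤ h
  h/2≤h = begin
    ½ ℚ.* h              ≡⟨ ℚ.+-identityʳ (½ ℚ.* h) ⟨
    ½ ℚ.* h ℚ.+ 0ℚ       ≤⟨ ℚ.+-monoʳ-≤ (½ ℚ.* h) (ℚ.<⇒≤ (half-pos (half-pos 0<ε))) ⟩
    ½ ℚ.* h ℚ.+ ½ ℚ.* h  ≡⟨ half+half h ⟩
    h                    ∎
...   | no large = contradiction
        (½ ℚ.* h , half-pos (half-pos 0<ε) , N , λ i N≤i → ℚ.≮⇒≥ λ xᵢ<h/2 → large
          (≡.subst₂ (λ p q → ℚ.∣ p ∣ ℚ.< q) (-‿telescope′ (seq x N) (seq x i)) (half+half h)
            (triangle {seq x N ℚ.- seq x i} (close N i ℕ.≤-refl N≤i) xᵢ<h/2)))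
        ¬x#0
  where
  h : ℚ
  h = ½ ℚ.* ε

-≈0⇒≈ : ∀ x y → x - y ≈ 0ℝ → x ≈ y
-≈0⇒≈ x y x-y≈0 ε 0<ε with x-y≈0 ε 0<ε
... | N , close = N , λ i N≤i →
  ≡.subst (λ p → ℚ.∣ p ∣ ℚ.< ε) (p-0≡p (seq x i ℚ.- seq y i)) (close i N≤i)

≈⇒-≈0 : ∀ x y → x ≈ y → x - y ≈ 0ℝ
≈⇒-≈0 x y x≈y ε 0<ε with x≈y ε 0<ε
... | N , close = N , λ i N≤i →
  ≡.subst (λ p → ℚ.∣ p ∣ ℚ.< ε) (≡.sym (p-0≡p (seq x i ℚ.- seq y i))) (close i N≤i)

-- Equality amounts to the negation of apartness of the difference from zero, and negations are
-- stable.
≈-stable : ∀ x y → ¬ ¬ (x ≈ y) → x ≈ y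
≈-stable x y ¬¬x≈y = -≈0⇒≈ x y (¬#0⇒≈0 {x - y} λ x-y#0 →
  ¬¬x≈y λ x≈y → #0⇒≉0 {x - y} x-y#0 (≈⇒-≈0 x y x≈y))

-- For distinct rationals the positive distance itself, taken as ε, gives a contradiction.
fromℚ-injective : ∀ {p q} → fromℚ p ≈ fromℚ q → p ≡ q
fromℚ-injective {p} {q} p≈q with p ℚ.≟ q
... | yes p≡q = p≡q
... | no  p≢q = contradiction ≡.refl (ℚ.<⇒≢ (close N ℕ.≤-refl))
  where
  distance-pos : 0ℚ ℚ.< ℚ.∣ p ℚ.- q ∣
  distance-pos = ℚ.≰⇒> λ ∣p-q∣≤0 → p≢q
    (≡.trans (≡.sym (-‿telescope′ p q))
      (≡.trans (≡.cong (ℚ._+ q) (ℚ.∣p∣≡0⇒p≡0 (p ℚ.- q) (ℚ.≤-antisym ∣p-q∣≤0 (ℚ.0≤∣p∣ (p ℚ.- q))))) (ℚ.+-identityˡ q)))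
  N : ℕ
  N = proj₁ (p≈q _ distance-pos)
  close : ∀ i → N ℕ.≤ i → ℚ.∣ p ℚ.- q ∣ ℚ.< ℚ.∣ p ℚ.- q ∣
  close = proj₂ (p≈q _ distance-pos)

fromℕ-injective : ∀ {a b} → fromℕ a ≈ fromℕ b → a ≡ b
fromℕ-injective {a} {b} a≈b with ℕ.<-cmp a b
... | tri≈ _ a≡b _ = a≡b
... | tri< a<b _ _ = contradiction (fromℚ-injective a≈b) (ℚ.<⇒≢ (/-mono-< a 0 b 0 (ℕ.*-monoˡ-< 1 a<b)))
... | tri> _ _ b<a = contradiction (≡.sym (fromℚ-injective a≈b)) (ℚ.<⇒≢ (/-mono-< b 0 a 0 (ℕ.*-monoˡ-< 1 b<a)))

-- Square roots

/-square : ∀ a d → (+ a ℚ./ suc d) ℚ.* (+ a ℚ./ suc d) ≡ + (a ℕ.* a) ℚ./ (suc d ℕ.* suc d)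
/-square a d = ℚ.toℚᵘ-injective
  (ℚᵘ.≃-trans (ℚ.toℚᵘ-homo-* (+ a ℚ./ suc d) (+ a ℚ./ suc d))
  (ℚᵘ.≃-trans (ℚᵘ.*-cong (ℚ.toℚᵘ-fromℚᵘ (ℚᵘ.mkℚᵘ (+ a) d)) (ℚ.toℚᵘ-fromℚᵘ (ℚᵘ.mkℚᵘ (+ a) d)))
  (ℚᵘ.≃-trans (ℚᵘ.*≡* (≡.cong (ℤ._* + (suc d ℕ.* suc d)) (≡.sym (ℤ.pos-* a a))))
    (ℚᵘ.≃-sym (ℚ.toℚᵘ-fromℚᵘ (ℚᵘ.mkℚᵘ (+ (a ℕ.* a)) (ℕ.pred (suc d ℕ.* suc d))))))))

-- The rounded-down root satisfies a² ≤ k < b² with b = a + 1/(i + 1). Hence the error k - a² is at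
-- most b² - a², which `*-close` makes small.
√-square : ∀ k → √ k * √ k ≈ fromℕ k
√-square k ε 0<ε =
  let A , 0<A , L , bound = eventuallyBounded (√ k)
      -- `A` bounds `a` and the increment `e` is at most 1, so `A + 1` bounds both `a` and `b`.
      0<C                 = ℚ.+-mono-< 0<A (ℚ.positive⁻¹ 1ℚ)
      δ , 0<δ , Cδ≡½ε     = shrink 0<C (half-pos 0<ε)
      M , small           = archimedean 0<δ
  in L ⊔ M , λ i i≥ →
    let a<A = bound i (ℕ.m⊔n≤o⇒m≤o L M i≥)
        e<δ = small i (ℕ.m⊔n≤o⇒n≤o L M i≥)
    in squeeze i (*-close {b i} {a i} {b i} {a i} 0<C Cδ≡½ε
         (ℚ.≤-<-trans (ℚ.∣p+q∣≤∣p∣+∣q∣ (a i) (e i))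
           (ℚ.+-mono-<-≤ a<A (≡.subst (ℚ._≤ 1ℚ) (≡.sym (∣e∣≡e i)) (e≤1 i))))
         (≡.subst (ℚ._< A ℚ.+ 1ℚ) (ℚ.+-identityʳ ℚ.∣ a i ∣) (ℚ.+-mono-<-≤ a<A (ℚ.nonNegative⁻¹ 1ℚ)))
         (∣b-a∣<δ i e<δ) (∣b-a∣<δ i e<δ))
  where
  module _ (i : ℕ) where
    a e b : ℚ
    a = √-seq k i
    e = + 1 ℚ./ suc i
    b = a ℚ.+ e

    a²≤k : a ℚ.* a ℚ.≤ + k ℚ./ 1
    a²≤k = ≡.subst (ℚ._≤ + k ℚ./ 1) (≡.sym (/-square (scaled k i) i))
      -- The comparison lemma takes predecessors of denominators: `i + i * suc i` is the predecessor
      -- of `suc i * suc i`.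
      (/-mono-≤ (scaled k i ℕ.* scaled k i) (i ℕ.+ i ℕ.* suc i) k 0
        (≡.subst (ℕ._≤ k ℕ.* (suc i ℕ.* suc i)) (≡.sym (ℕ.*-identityʳ _)) (isqrt-lower (k ℕ.* (suc i ℕ.* suc i)))))

    k<b² : + k ℚ./ 1 ℚ.< b ℚ.* b
    k<b² = ≡.subst (+ k ℚ./ 1 ℚ.<_)
      (≡.trans (≡.sym (/-square (suc (scaled k i)) i)) (≡.cong₂ ℚ._*_ (/-suc (scaled k i) i) (/-suc (scaled k i) i)))
      (/-mono-< k 0 (suc (scaled k i) ℕ.* suc (scaled k i)) (i ℕ.+ i ℕ.* suc i)
        (≡.subst (k ℕ.* (suc i ℕ.* suc i) ℕ.<_) (≡.sym (ℕ.*-identityʳ _)) (isqrt-upper (k ℕ.* (suc i ℕ.* suc i)))))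

    e≤1 : e ℚ.≤ 1ℚ
    e≤1 = /-mono-≤ 1 i 1 0 (s≤s z≤n)

    ∣e∣≡e : ℚ.∣ e ∣ ≡ e
    ∣e∣≡e = ℚ.0≤p⇒∣p∣≡p (/-mono-≤ 0 0 1 i z≤n)

    ∣b-a∣<δ : ∀ {δ} → e ℚ.< δ → ℚ.∣ b ℚ.- a ∣ ℚ.< δ
    ∣b-a∣<δ {δ} = ≡.subst (ℚ._< δ) (≡.sym (≡.trans (≡.cong ℚ.∣_∣ (p+q-p≡q a e)) ∣e∣≡e))

    squeeze : ℚ.∣ b ℚ.* b ℚ.- a ℚ.* a ∣ ℚ.< ε → ℚ.∣ a ℚ.* a ℚ.- + k ℚ./ 1 ∣ ℚ.< ε
    squeeze b²-a²<ε = begin-strict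
      ℚ.∣ a ℚ.* a ℚ.- + k ℚ./ 1 ∣   ≡⟨ ∣p-q∣≡∣q-p∣ (a ℚ.* a) (+ k ℚ./ 1) ⟩
      ℚ.∣ + k ℚ./ 1 ℚ.- a ℚ.* a ∣   ≡⟨ ℚ.0≤p⇒∣p∣≡p (p≤q⇒0≤q-p a²≤k) ⟩
      + k ℚ./ 1 ℚ.- a ℚ.* a         ≤⟨ ℚ.+-monoˡ-≤ (ℚ.- (a ℚ.* a)) (ℚ.<⇒≤ k<b²) ⟩
      b ℚ.* b ℚ.- a ℚ.* a           ≡⟨ ℚ.0≤p⇒∣p∣≡p (p≤q⇒0≤q-p (ℚ.≤-trans a²≤k (ℚ.<⇒≤ k<b²))) ⟨
      ℚ.∣ b ℚ.* b ℚ.- a ℚ.* a ∣     <⟨ b²-a²<ε ⟩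
      ε                             ∎
      where open ℚ.≤-Reasoning

private
  module ℝᵈ = Determinant ℝ-commutativeRing
  module ℝᶜ = CommutativeRing ℝ-commutativeRing

open RingLemmas ℝ-commutativeRing
open import Algebra.Properties.Monoid.Mult ℝᶜ.+-monoid using (×-homo-+) renaming (_×_ to _·_)
open import Algebra.Properties.Semiring.Mult ℝᶜ.semiring using (×1-homo-*)
open import Algebra.Properties.CommutativeMonoid.Sum ℝᶜ.+-commutativeMonoid using (sum-cong-≗)
open import Relation.Binary.Reasoning.Setoid ℝᶜ.setoid

-- Natural numbers as multiples of one

fromℕ≈· : ∀ n → fromℕ n ≈ n · 1ℝ
fromℕ≈· zero    = ≈-refl {0ℝ}
fromℕ≈· (suc n) = begin
  fromℕ (suc n)  ≈⟨ pointwise (fromℕ (suc n)) (1ℝ + fromℕ n) (λ _ → ≡.trans (/-suc n 0) (ℚ.+-comm (+ n ℚ./ 1) 1ℚ)) ⟩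
  1ℝ + fromℕ n   ≈⟨ ℝᶜ.+-congˡ {1ℝ} {fromℕ n} {n · 1ℝ} (fromℕ≈· n) ⟩
  1ℝ + n · 1ℝ    ∎

·-injective : ∀ a b → a · 1ℝ ≈ b · 1ℝ → a ≡ b
·-injective a b eq = fromℕ-injective (begin
  fromℕ a  ≈⟨ fromℕ≈· a ⟩
  a · 1ℝ   ≈⟨ eq ⟩
  b · 1ℝ   ≈⟨ fromℕ≈· b ⟨
  fromℕ b  ∎)

-- The Randić matrix of a complete bipartite graph

open Graph

-- The product of degrees is replaced by a variable `k`. Once the equation is matched, the two sides
-- differ only in the proof of `NonZero`, which is irrelevant.
randić-adjacent : ∀ {N} (G : Graph N) {i j} k .{{_ : NonZero k}} → Adj G i j →
  degree G i ℕ.* degree G j ≡ k → randićMatrix G i j ≡ 1/√ k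
randić-adjacent G {i} {j} k a ≡.refl with adj? G i j
... | yes _ = ≡.refl
... | no ¬a = contradiction a ¬a

randić-nonadjacent : ∀ {N} (G : Graph N) {i j} → ¬ Adj G i j → randićMatrix G i j ≡ 0ℝ
randić-nonadjacent G {i} {j} ¬a with adj? G i j
... | yes a = contradiction a ¬a
... | no  _ = ≡.refl

tabulate-+ : ∀ {a} {A : Set a} m n (f : Fin (m ℕ.+ n) → A) →
  tabulate f ≡ tabulate (λ i → f (i Fin.↑ˡ n)) ++ tabulate (λ j → f (m Fin.↑ʳ j))
tabulate-+ zero    n f = ≡.refl
tabulate-+ (suc m) n f = ≡.cong (f zero ∷_) (tabulate-+ m n (f ∘ suc))

module _ (m n : ℕ) where

  private
    degree-split : ∀ i → degree (K m n) i ≡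
      length (filter (adj? (K m n) i) (tabulate {n = m} (Fin._↑ˡ n))) ℕ.+
      length (filter (adj? (K m n) i) (tabulate {n = n} (m Fin.↑ʳ_)))
    degree-split i = ≡.trans
      (≡.cong (length ∘ filter (adj? (K m n) i)) (tabulate-+ m n id))
      (≡.trans (≡.cong length (List.filter-++ (adj? (K m n) i) (tabulate {n = m} (Fin._↑ˡ n)) _))
        (List.length-++ (filter (adj? (K m n) i) (tabulate {n = m} (Fin._↑ˡ n)))))

    count-all : ∀ {k} i (f : Fin k → Fin (m ℕ.+ n)) → (∀ j → Adj (K m n) i (f j)) →
      length (filter (adj? (K m n) i) (tabulate f)) ≡ k
    count-all i f adj = ≡.trans (≡.cong length (List.filter-all (adj? (K m n) i) (All.tabulate⁺ adj)))
      (List.length-tabulate f)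

    count-none : ∀ {k} i (f : Fin k → Fin (m ℕ.+ n)) → (∀ j → ¬ Adj (K m n) i (f j)) →
      length (filter (adj? (K m n) i) (tabulate f)) ≡ 0
    count-none i f ¬adj = ≡.cong length (List.filter-none (adj? (K m n) i) (All.tabulate⁺ ¬adj))

  degree-K-inj₁ : ∀ {i a} → splitAt m i ≡ inj₁ a → degree (K m n) i ≡ n
  degree-K-inj₁ {i} eq = ≡.trans (degree-split i) (≡.cong₂ ℕ._+_
    (count-none i (Fin._↑ˡ n) λ j → ≡.subst₂ (λ s t → ¬ Opposite s t) (≡.sym eq) (≡.sym (Fin.splitAt-↑ˡ m j n)) λ ())
    (count-all i (m Fin.↑ʳ_) λ j → ≡.subst₂ Opposite (≡.sym eq) (≡.sym (Fin.splitAt-↑ʳ m n j)) _))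

  degree-K-inj₂ : ∀ {i b} → splitAt m i ≡ inj₂ b → degree (K m n) i ≡ m
  degree-K-inj₂ {i} eq = ≡.trans (degree-split i) (≡.trans (≡.cong₂ ℕ._+_
    (count-all i (Fin._↑ˡ n) λ j → ≡.subst₂ Opposite (≡.sym eq) (≡.sym (Fin.splitAt-↑ˡ m j n)) _)
    (count-none i (m Fin.↑ʳ_) λ j → ≡.subst₂ (λ s t → ¬ Opposite s t) (≡.sym eq) (≡.sym (Fin.splitAt-↑ʳ m n j)) λ ()))
    (ℕ.+-identityʳ m))

  -- The degrees at the two ends of an edge are n and m in some order, so every nonzero entry has
  -- the same weight. The sides enter as equations because the degree lemmas consume them in that
  -- form.
  randić-K : .{{_ : NonZero (m ℕ.* n)}} → ∀ i j {s t} → splitAt m i ≡ s → splitAt m j ≡ t →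
    - randićMatrix (K m n) i j ≈ ℝᵈ.link (- 1/√ (m ℕ.* n)) 0ℝ s t
  randić-K i j {inj₁ _} {inj₁ _} eqᵢ eqⱼ = begin
    - randićMatrix (K m n) i j  ≡⟨ ≡.cong -_ (randić-nonadjacent (K m n)
                                     (≡.subst₂ (λ s t → ¬ Opposite s t) (≡.sym eqᵢ) (≡.sym eqⱼ) λ ())) ⟩
    - 0ℝ                        ≈⟨ pointwise (- 0ℝ) 0ℝ (λ _ → ≡.refl) ⟩
    0ℝ                          ∎
  randić-K i j {inj₂ _} {inj₂ _} eqᵢ eqⱼ = begin
    - randićMatrix (K m n) i j  ≡⟨ ≡.cong -_ (randić-nonadjacent (K m n)
                                     (≡.subst₂ (λ s t → ¬ Opposite s t) (≡.sym eqᵢ) (≡.sym eqⱼ) λ ())) ⟩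
    - 0ℝ                        ≈⟨ pointwise (- 0ℝ) 0ℝ (λ _ → ≡.refl) ⟩
    0ℝ                          ∎
  randić-K i j {inj₁ _} {inj₂ _} eqᵢ eqⱼ = ℝᶜ.reflexive (≡.cong -_ (randić-adjacent (K m n) (m ℕ.* n)
    (≡.subst₂ Opposite (≡.sym eqᵢ) (≡.sym eqⱼ) _)
    (≡.trans (≡.cong₂ ℕ._*_ (degree-K-inj₁ eqᵢ) (degree-K-inj₂ eqⱼ)) (ℕ.*-comm n m))))
  randić-K i j {inj₂ _} {inj₁ _} eqᵢ eqⱼ = ℝᶜ.reflexive (≡.cong -_ (randić-adjacent (K m n) (m ℕ.* n)
    (≡.subst₂ Opposite (≡.sym eqᵢ) (≡.sym eqⱼ) _)
    (≡.cong₂ ℕ._*_ (degree-K-inj₂ eqᵢ) (degree-K-inj₁ eqⱼ))))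

-- Both determinants follow the same recursion, so their summands agree one by one; this transfers
-- the ring-generic results to the reals.
det≡ : ∀ {n} (A : Matrix n) → det A ≡ ℝᵈ.det A
det≡ {zero}  A = ≡.refl
det≡ {suc n} A = sum-cong-≗ λ j → ≡.cong (λ d → (- 1ℝ) ^ toℕ j * (A zero j * d)) (det≡ λ i k → A (suc i) (punchIn j k))

scalar≡ : ∀ {n} x (i j : Fin n) → scalar x i j ≡ ℝᵈ.scalar x i j
scalar≡ x i j with i Fin.≟ j
... | yes _ = ≡.refl
... | no  _ = ≡.refl

RP-K : ∀ m n x → RP (K (suc m) (suc n)) x ≈ x ^ (m ℕ.+ n) * (x ^ 2 - 1ℝ)
RP-K m n x = begin
  det (scalar x -ᴹ randićMatrix (K M N))
    ≡⟨ det≡ (scalar x -ᴹ randićMatrix (K M N)) ⟩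
  ℝᵈ.det (scalar x -ᴹ randićMatrix (K M N))
    ≈⟨ ℝᵈ.det-cong {A = scalar x -ᴹ randićMatrix (K M N)} {B = ℝᵈ.bipartite M N x (- t) 0ℝ}
         (λ i j → ℝᶜ.+-cong {scalar x i j} {ℝᵈ.scalar x i j}
            {u = - randićMatrix (K M N) i j} {v = ℝᵈ.link (- t) 0ℝ (splitAt M i) (splitAt M j)}
            (ℝᶜ.reflexive (scalar≡ x i j)) (randić-K M N i j ≡.refl ≡.refl)) ⟩
  ℝᵈ.det (ℝᵈ.bipartite M N x (- t) 0ℝ)
    ≈⟨ ℝᵈ.det-bipartite m n x (- t) 0ℝ t (ℝᶜ.-‿inverseˡ t) ⟩
  x ^ (m ℕ.+ n) * (x * x + (N · 1ℝ) * 0ℝ * x + (M · 1ℝ) * (N · 1ℝ) * (- t * t))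
    ≈⟨ bipartite-factor (x ^ (m ℕ.+ n)) x (M · 1ℝ) (N · 1ℝ) t normalised ⟩
  x ^ (m ℕ.+ n) * (x ^ 2 - 1ℝ) ∎
  where
  M N : ℕ
  M = suc m
  N = suc n
  t : ℝ
  t = 1/√ (M ℕ.* N)
  normalised : (M · 1ℝ) * (N · 1ℝ) * (t * t) ≈ 1ℝ
  normalised = begin
    (M · 1ℝ) * (N · 1ℝ) * (t * t)
      ≈⟨ ℝᶜ.*-congʳ {t * t} {(M ℕ.* N) · 1ℝ} {(M · 1ℝ) * (N · 1ℝ)} (×1-homo-* M N) ⟨
    ((M ℕ.* N) · 1ℝ) * (t * t)
      ≈⟨ ℝᶜ.*-congʳ {t * t} {fromℕ (M ℕ.* N)} {(M ℕ.* N) · 1ℝ} (fromℕ≈· (M ℕ.* N)) ⟨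
    fromℕ (M ℕ.* N) * (t * t)
      ≈⟨ inverse-square {√ (M ℕ.* N)} {fromℕ (M ℕ.* N)} {t} (√-square (M ℕ.* N)) (*-inv (√ (M ℕ.* N)) (√-#0 (M ℕ.* N))) ⟩
    1ℝ ∎

-- The energy of a spectrum with characteristic polynomial xᵏ(x² − 1)

prime[3] : Prime 3
prime[3] = from-yes (prime? 3)

3∤2^ : ∀ a → ¬ (3 ∣ 2 ℕ.^ a)
3∤2^ zero    3∣1 = contradiction (∣⇒≤ 3∣1) λ { (ℕ.s≤s ()) }
3∤2^ (suc a) 3∣  with euclidsLemma 2 (2 ℕ.^ a) prime[3] 3∣
... | inj₁ 3∣2  = contradiction (∣⇒≤ 3∣2) λ { (ℕ.s≤s (ℕ.s≤s ())) }
... | inj₂ 3∣2^ = 3∤2^ a 3∣2^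

2^-injective : ∀ {a b} → 2 ℕ.^ a ≡ 2 ℕ.^ b → a ≡ b
2^-injective {a} {b} eq with ℕ.<-cmp a b
... | tri≈ _ a≡b _ = a≡b
... | tri< a<b _ _ = contradiction eq (ℕ.<⇒≢ (ℕ.^-monoʳ-< 2 (ℕ.s≤s (ℕ.s≤s ℕ.z≤n)) a<b))
... | tri> _ _ b<a = contradiction (≡.sym eq) (ℕ.<⇒≢ (ℕ.^-monoʳ-< 2 (ℕ.s≤s (ℕ.s≤s ℕ.z≤n)) b<a))

-- Any c other than 1 makes 3 divide a power of 2, directly for c = 0 and after cancelling one
-- factor 3 for c ≥ 2.
2^a3^c≡2^k3⇒a≡k : ∀ a c k → 2 ℕ.^ a ℕ.* 3 ℕ.^ c ≡ 2 ℕ.^ k ℕ.* 3 → a ≡ k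
2^a3^c≡2^k3⇒a≡k a zero k eq = contradiction
  (divides (2 ℕ.^ k) (≡.trans (≡.sym (ℕ.*-identityʳ (2 ℕ.^ a))) eq)) (3∤2^ a)
2^a3^c≡2^k3⇒a≡k a (suc c) k eq = cancelled c (ℕ.*-cancelʳ-≡ _ _ 3 (≡.trans (regroup (2 ℕ.^ a) (3 ℕ.^ c)) eq))
  where
  regroup : ∀ p q → (p ℕ.* q) ℕ.* 3 ≡ p ℕ.* (3 ℕ.* q)
  regroup = ℕ.solve-∀
  cancelled : ∀ c → 2 ℕ.^ a ℕ.* 3 ℕ.^ c ≡ 2 ℕ.^ k → a ≡ k
  cancelled zero    eq = 2^-injective (≡.trans (≡.sym (ℕ.*-identityʳ (2 ℕ.^ a))) eq)
  cancelled (suc c) eq = contradiction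
    (divides (2 ℕ.^ a ℕ.* 3 ℕ.^ c) (≡.trans (≡.sym eq) (≡.sym (regroup (2 ℕ.^ a) (3 ℕ.^ c))))) (3∤2^ k)

IsSignOrZero : ℝ → Set
IsSignOrZero r = r ≈ 0ℝ ⊎ r ≈ 1ℝ ⊎ r ≈ - 1ℝ

-- A vanishing product of reals does not constructively reveal a vanishing factor, hence the double
-- negation. Under it, `r` and r - 1 may be assumed zero or apart from zero; if both are apart, they
-- are invertible and cancel, leaving r + 1 = 0.
root-isSignOrZero : ∀ k r → r ^ k * (r ^ 2 - 1ℝ) ≈ 0ℝ → ¬ ¬ IsSignOrZero r
root-isSignOrZero k r eq ¬root = ¬¬-excluded-middle λ where
    (no ¬r#0) → ¬root (inj₁ (¬#0⇒≈0 {r} ¬r#0))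
    (yes r#0) → ¬¬-excluded-middle λ where
      (no ¬r-1#0) → ¬root (inj₂ (inj₁ (-≈0⇒≈ r 1ℝ (¬#0⇒≈0 {r - 1ℝ} ¬r-1#0))))
      (yes r-1#0) → ¬root (inj₂ (inj₂ (-≈0⇒≈ r (- 1ℝ)
        (unit-cancel {r - 1ℝ} {inv (r - 1ℝ) r-1#0} {r - - 1ℝ} (*-inv (r - 1ℝ) r-1#0) (begin
          (r - 1ℝ) * (r - - 1ℝ)  ≈⟨ pointwise ((r - 1ℝ) * (r - - 1ℝ)) (r ^ 2 - 1ℝ) (λ i → factor (seq r i)) ⟩
          r ^ 2 - 1ℝ             ≈⟨ unit-^-cancel {r} {inv r r#0} {r ^ 2 - 1ℝ} (*-inv r r#0) k eq ⟩
          0ℝ                     ∎)))))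
  where
  factor : ∀ p → (p ℚ.- 1ℚ) ℚ.* (p ℚ.- (ℚ.- 1ℚ)) ≡ p ℚ.* (p ℚ.* 1ℚ) ℚ.- 1ℚ
  factor = solve-∀ ℚ-ring

two : ℝ
two = 2 · 1ℝ

*-· : ∀ {x y} a b → x ≈ a · 1ℝ → y ≈ b · 1ℝ → x * y ≈ (a ℕ.* b) · 1ℝ
*-· {x} {y} a b x≈a y≈b = begin
  x * y                ≈⟨ ℝᶜ.*-cong {x} {a · 1ℝ} {y} {b · 1ℝ} x≈a y≈b ⟩
  (a · 1ℝ) * (b · 1ℝ)  ≈⟨ ×1-homo-* a b ⟨
  (a ℕ.* b) · 1ℝ       ∎

+-· : ∀ {x y} a b → x ≈ a · 1ℝ → y ≈ b · 1ℝ → x + y ≈ (a ℕ.+ b) · 1ℝ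
+-· {x} {y} a b x≈a y≈b = begin
  x + y                ≈⟨ ℝᶜ.+-cong {x} {a · 1ℝ} {y} {b · 1ℝ} x≈a y≈b ⟩
  (a · 1ℝ) + (b · 1ℝ)  ≈⟨ ×-homo-+ 1ℝ a b ⟨
  (a ℕ.+ b) · 1ℝ       ∎

-- One more root of value `v` multiplies the product by its gap g = 2 - v and adds its weight w =
-- |v| to the sum. The results `p′` and `q′` are given up to an equation, so that each case can
-- restore the form 2ᵃ·3ᶜ.
tally-cons : ∀ {N} (ρ : Vector ℝ (suc N)) v g w p q {p′ q′} →
  ρ zero ≈ v → two - v ≈ g · 1ℝ → ∣ v ∣ ≈ w · 1ℝ → g ℕ.* p ≡ p′ → w ℕ.+ q ≡ q′ →
  product (λ i → two - ρ (suc i)) ≈ p · 1ℝ × sum (λ i → ∣ ρ (suc i) ∣) ≈ q · 1ℝ →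
  product (λ i → two - ρ i) ≈ p′ · 1ℝ × sum (λ i → ∣ ρ i ∣) ≈ q′ · 1ℝ
tally-cons ρ v g w p q r≈v gap weight ≡.refl ≡.refl (prod , total) =
  *-· {two - ρ zero} {product (λ i → two - ρ (suc i))} g p (begin
    two - ρ zero  ≈⟨ ℝᶜ.+-congˡ {two} {(- ρ zero)} {(- v)} (ℝᶜ.-‿cong {ρ zero} {v} r≈v) ⟩
    two - v       ≈⟨ gap ⟩
    g · 1ℝ        ∎) prod ,
  +-· {∣ ρ zero ∣} {sum (λ i → ∣ ρ (suc i) ∣)} w q (begin
    ∣ ρ zero ∣    ≈⟨ ∣∣-cong {ρ zero} {v} r≈v ⟩
    ∣ v ∣         ≈⟨ weight ⟩
    w · 1ℝ        ∎) total

-- The numbers `a`, `b` and `c` count the values 0, 1 and -1, whose gaps to 2 are 2, 1 and 3 and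
-- whose absolute values are 0, 1 and 1.
tally : ∀ {N} (ρ : Vector ℝ N) → (∀ i → IsSignOrZero (ρ i)) → ∃[ a ] ∃[ b ] ∃[ c ]
  a ℕ.+ b ℕ.+ c ≡ N ×
  product (λ i → two - ρ i) ≈ (2 ℕ.^ a ℕ.* 3 ℕ.^ c) · 1ℝ ×
  sum (λ i → ∣ ρ i ∣) ≈ (b ℕ.+ c) · 1ℝ
tally {zero}  ρ root = 0 , 0 , 0 , ≡.refl , pointwise 1ℝ (1 · 1ℝ) (λ _ → ≡.refl) , ≈-refl {0ℝ}
tally {suc N} ρ root with root zero | tally (ρ ∘ suc) (root ∘ suc)
... | inj₁ r≈0 | a , b , c , count , rest =
  suc a , b , c , ≡.cong suc count , tally-cons ρ 0ℝ 2 0 (2 ℕ.^ a ℕ.* 3 ℕ.^ c) (b ℕ.+ c) r≈0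
    (pointwise (two - 0ℝ) (2 · 1ℝ) λ _ → ≡.refl) (pointwise ∣ 0ℝ ∣ 0ℝ λ _ → ≡.refl)
    (≡.sym (ℕ.*-assoc 2 (2 ℕ.^ a) (3 ℕ.^ c))) ≡.refl rest
... | inj₂ (inj₁ r≈1) | a , b , c , count , rest =
  a , suc b , c , ≡.trans (≡.cong (ℕ._+ c) (ℕ.+-suc a b)) (≡.cong suc count) , tally-cons ρ 1ℝ 1 1 (2 ℕ.^ a ℕ.* 3 ℕ.^ c) (b ℕ.+ c) r≈1
    (pointwise (two - 1ℝ) (1 · 1ℝ) λ _ → ≡.refl) (pointwise ∣ 1ℝ ∣ (1 · 1ℝ) λ _ → ≡.refl)
    (ℕ.*-identityˡ (2 ℕ.^ a ℕ.* 3 ℕ.^ c)) ≡.refl rest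
... | inj₂ (inj₂ r≈-1) | a , b , c , count , rest =
  a , b , suc c , ≡.trans (ℕ.+-suc (a ℕ.+ b) c) (≡.cong suc count) , tally-cons ρ (- 1ℝ) 3 1 (2 ℕ.^ a ℕ.* 3 ℕ.^ c) (b ℕ.+ c) r≈-1
    (pointwise (two - - 1ℝ) (3 · 1ℝ) λ _ → ≡.refl) (pointwise ∣ - 1ℝ ∣ (1 · 1ℝ) λ _ → ≡.refl)
    (swap (2 ℕ.^ a) (3 ℕ.^ c)) (≡.sym (ℕ.+-suc b c)) rest
  where
  swap : ∀ p q → 3 ℕ.* (p ℕ.* q) ≡ p ℕ.* (3 ℕ.* q)
  swap = ℕ.solve-∀

two^k*3 : ∀ k → two ^ k * (two ^ 2 - 1ℝ) ≈ (2 ℕ.^ k ℕ.* 3) · 1ℝ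
two^k*3 k = *-· {two ^ k} {two ^ 2 - 1ℝ} (2 ℕ.^ k) 3 (·-^ 2 k)
  (pointwise (two ^ 2 - 1ℝ) (3 · 1ℝ) λ _ → ≡.refl)

energy≈2 : ∀ k (ρ : Vector ℝ (2 ℕ.+ k)) →
  (∀ x → x ^ k * (x ^ 2 - 1ℝ) ≈ product (λ i → x - ρ i)) → sum (λ i → ∣ ρ i ∣) ≈ fromℕ 2
energy≈2 k ρ eq = ≈-stable (sum (λ i → ∣ ρ i ∣)) (fromℕ 2) (¬¬-map energy
  -- Each root is classified only up to double negation. Since there are finitely many, the double
  -- negations combine into one in front of the quantifier. Evaluation at `ρ i` makes the i-th
  -- factor zero, so `ρ i` is a root.
  (Fin.sequence (RawMonad.rawApplicative ¬¬-Monad) λ i → root-isSignOrZero k (ρ i) (begin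
    ρ i ^ k * (ρ i ^ 2 - 1ℝ)      ≈⟨ eq (ρ i) ⟩
    product (λ j → ρ i - ρ j)     ≈⟨ product≈0 (λ j → ρ i - ρ j) i (ℝᶜ.-‿inverseʳ (ρ i)) ⟩
    0ℝ                            ∎)))
  where
  b+c≡2 : ∀ {a b c} → a ℕ.+ b ℕ.+ c ≡ 2 ℕ.+ k → a ≡ k → b ℕ.+ c ≡ 2
  b+c≡2 {a} {b} {c} count a≡k = ℕ.+-cancelˡ-≡ a (b ℕ.+ c) 2 (≡.trans (≡.sym (ℕ.+-assoc a b c))
    (≡.trans count (≡.trans (≡.cong (2 ℕ.+_) (≡.sym a≡k)) (ℕ.+-comm 2 a))))

  energy : (∀ i → IsSignOrZero (ρ i)) → sum (λ i → ∣ ρ i ∣) ≈ fromℕ 2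
  energy root =
    let a , b , c , count , prod , total = tally ρ root
        2^a3^c≡2^k3 = ·-injective (2 ℕ.^ a ℕ.* 3 ℕ.^ c) (2 ℕ.^ k ℕ.* 3) (begin
          (2 ℕ.^ a ℕ.* 3 ℕ.^ c) · 1ℝ  ≈⟨ prod ⟨
          product (λ i → two - ρ i)   ≈⟨ eq two ⟨
          two ^ k * (two ^ 2 - 1ℝ)    ≈⟨ two^k*3 k ⟩
          (2 ℕ.^ k ℕ.* 3) · 1ℝ        ∎)
    in begin
      sum (λ i → ∣ ρ i ∣)  ≈⟨ total ⟩
      (b ℕ.+ c) · 1ℝ       ≡⟨ ≡.cong (_· 1ℝ) (b+c≡2 {a} {b} {c} count (2^a3^c≡2^k3⇒a≡k a c k 2^a3^c≡2^k3)) ⟩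
      2 · 1ℝ               ≈⟨ fromℕ≈· 2 ⟨
      fromℕ 2              ∎

-- An explicit spectrum and the energy

eigenvalue : ℕ → ℝ
eigenvalue 0             = 1ℝ
eigenvalue 1             = - 1ℝ
eigenvalue (suc (suc _)) = 0ℝ

product-constant : ∀ x k → product {k} (λ _ → x - 0ℝ) ≈ x ^ k
product-constant x zero    = ≈-refl {1ℝ}
product-constant x (suc k) = ℝᶜ.*-cong {x - 0ℝ} {x} {product {k} (λ _ → x - 0ℝ)} {x ^ k}
  (pointwise (x - 0ℝ) x λ i → ℚ.+-identityʳ (seq x i)) (product-constant x k)

-- From the third index on, `eigenvalue (toℕ i)` reduces to `0ℝ`, so the product unfolds to (x -
-- 1)(x + 1) times a product of `k` equal factors.
product-eigenvalue : ∀ k x → x ^ k * (x ^ 2 - 1ℝ) ≈ product {2 ℕ.+ k} (λ i → x - eigenvalue (toℕ i))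
product-eigenvalue k x = begin
  x ^ k * (x ^ 2 - 1ℝ)
    ≈⟨ pointwise (x ^ k * (x ^ 2 - 1ℝ)) ((x - 1ℝ) * ((x - - 1ℝ) * x ^ k)) (λ i → factor (seq x i) (seq (x ^ k) i)) ⟩
  (x - 1ℝ) * ((x - - 1ℝ) * x ^ k)
    ≈⟨ ℝᶜ.*-congˡ {x - 1ℝ} {(x - - 1ℝ) * P} {(x - - 1ℝ) * x ^ k}
         (ℝᶜ.*-congˡ {x - - 1ℝ} {P} {x ^ k} (product-constant x k)) ⟨
  (x - 1ℝ) * ((x - - 1ℝ) * P) ∎
  where
  P : ℝ
  P = product {k} (λ _ → x - 0ℝ)
  factor : ∀ p q → q ℚ.* (p ℚ.* (p ℚ.* 1ℚ) ℚ.- 1ℚ) ≡ (p ℚ.- 1ℚ) ℚ.* ((p ℚ.- (ℚ.- 1ℚ)) ℚ.* q)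
  factor = solve-∀ ℚ-ring

-- The number of vertices is a variable tied to 2 + k by an equation: for `K (suc m) (suc n)` it
-- equals 2 + (m + n) only propositionally, and matching here avoids transporting the graph.
randićEnergy≈2 : ∀ {N} (G : Graph N) k → N ≡ 2 ℕ.+ k →
  (∀ x → RP G x ≈ x ^ k * (x ^ 2 - 1ℝ)) → IsRandićEnergy G (fromℕ 2)
randićEnergy≈2 G k ≡.refl RP≈ = record
  { spectrum   = λ i → eigenvalue (toℕ i)
  ; isSpectrum = λ x → ℝᶜ.trans {RP G x} {x ^ k * (x ^ 2 - 1ℝ)} {product {2 ℕ.+ k} (λ i → x - eigenvalue (toℕ i))}
                   (RP≈ x) (product-eigenvalue k x)
  ; energy     = λ ρ isSpectrum → energy≈2 k ρ λ x →
                   ℝᶜ.trans {x ^ k * (x ^ 2 - 1ℝ)} {RP G x} {product {2 ℕ.+ k} (λ i → x - ρ i)}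
                     (ℝᶜ.sym {RP G x} {x ^ k * (x ^ 2 - 1ℝ)} (RP≈ x)) (isSpectrum x)
  }

theorem5 : (m n : ℕ) → .{{NonZero m}} → .{{NonZero n}} → m ≢ 1 → n ≢ 1 →
    (∀ (x : ℝ) → RP (K m n) x ≈ x ^ (m ℕ.+ n ℕ.∸ 2) * (x ^ 2 - 1ℝ))
    × IsRandićEnergy (K m n) (fromℕ 2)
theorem5 (suc m) (suc n) _ _ =
  -- `suc m + suc n ∸ 2` computes to `m + suc n ∸ 1`, so one use of `+-suc` identifies the exponent
  -- with `m + n`.
  (λ x → ≡.subst (λ k → RP (K (suc m) (suc n)) x ≈ x ^ k * (x ^ 2 - 1ℝ))
           (≡.cong (ℕ._∸ 1) (≡.sym (ℕ.+-suc m n))) (RP-K m n x)) ,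
  randićEnergy≈2 (K (suc m) (suc n)) (m ℕ.+ n) (≡.cong suc (ℕ.+-suc m n)) (RP-K m n)
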